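{- Let $r,c$ be odd positive integers. The number $a(r,c)$ of near-perfect matchings of the $r\times c$ grid graph is odd if and only if both $r$ and $c$ are congruent to $1$ mod $4$ and $\gcd(r+1,c+1)=2$.
   Context: The $r\times c$ grid graph has vertex set $\{1,\dots,r\}\times\{1,\dots,c\}$, with two vertices adjacent when they differ by $1$ in exactly one coordinate. A near-perfect matching is a set of pairwise disjoint edges covering all vertices but one. -}

module Defs where

open import Data.Bool using (Bool; true; false; _∧_; _∨_; if_then_else_)
open import Data.Nat using (ℕ; zero; suc; _+_; _≡ᵇ_; _≤ᵇ_)
open import Data.List using (List; []; _∷_; map; _++_; filter; length; upTo; cartesianProduct)
open import Data.Bool.ListAction using (and)
open import Data.Product using (_×_; _,_)
open import Relation.Nullary.Decidable using (T?)
open import Function using (_∘_)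

-- Vertices of the r × c grid graph, 0-based: {0..r-1} × {0..c-1}
-- (isomorphic to the paper's {1..r} × {1..c}).
Vertex : Set
Vertex = ℕ × ℕ

vertices : ℕ → ℕ → List Vertex
vertices r c = cartesianProduct (upTo r) (upTo c)

adjOriented : Vertex → Vertex → Bool
adjOriented (i , j) (i' , j') =
  ((i ≡ᵇ i') ∧ (suc j ≡ᵇ j')) ∨ ((j ≡ᵇ j') ∧ (suc i ≡ᵇ i'))

Edge : Set
Edge = Vertex × Vertex

-- every edge of the grid graph, each listed exactly once
edges : ℕ → ℕ → List Edge
edges r c =
  filter (λ e → T? (adjOriented (Data.Product.proj₁ e) (Data.Product.proj₂ e)))
         (cartesianProduct (vertices r c) (vertices r c))

subsets : {A : Set} → List A → List (List A)
subsets [] = [] ∷ []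
subsets (x ∷ xs) = let s = subsets xs in s ++ map (x ∷_) s

eqV : Vertex → Vertex → Bool
eqV (i , j) (i' , j') = (i ≡ᵇ i') ∧ (j ≡ᵇ j')

incident : Vertex → Edge → Bool
incident v (a , b) = eqV v a ∨ eqV v b

degree : List Edge → Vertex → ℕ
degree M v = length (filter (λ e → T? (incident v e)) M)

isNearPerfect : ℕ → ℕ → List Edge → Bool
isNearPerfect r c M =
  and (map (λ v → degree M v ≤ᵇ 1) (vertices r c))
  ∧ (length (filter (λ v → T? (degree M v ≡ᵇ 0)) (vertices r c)) ≡ᵇ 1)

nearPerfectCount : ℕ → ℕ → ℕ
nearPerfectCount r c =
  length (filter (λ M → T? (isNearPerfect r c M)) (subsets (edges r c)))

{-# OPTIONS --safe #-}
-- Modulo 2, the number of perfect matchings of a graph is the Pfaffian of its adjacency matrix over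
-- the field with two elements, and near-perfect matchings are the perfect matchings of the cone over
-- the graph. Write r = 2 s + 1. Adding to each vertex of one half of the grid its mirror image (a
-- congruence of the alternating form) splits the Pfaffian of the cone into det (A (s × c)), where A is
-- the adjacency matrix of the s × c grid, and the number of near-perfect matchings of the path with c
-- vertices, which is (c + 1) / 2.
--
-- For the determinant d (n , m) of the n × m grid, consider m consecutive rows and the row t next to
-- them. Solving the neighbour-sum equation backwards from a unit vector in the first of the m rows
-- gives sets S of vertices (tilted rectangles) whose only odd neighbour is a prescribed vertex of
-- row t, since the Chebyshev polynomial U_m annihilates the path. Pivoting on them removes two rows and
-- yields d (t + 1 + m , m) = d (t , m) d (m - 1 , m), while d (m , m) = 0 because of the diagonal.
-- This is Euclid's algorithm on (n + 1 , m + 1), so d (n , m) = 1 if and only if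
-- gcd (n + 1 , m + 1) = 1.

module Submission where

open import Defs
open import Algebra.Bundles using (CommutativeRing; CommutativeMonoid)
import Algebra.Properties.CommutativeSemigroup as CommutativeSemigroupProperties
open import Data.Bool using (Bool; true; false; not; T; _∧_; _∨_; _xor_)
open import Data.Bool.ListAction using (and; all)
open import Data.Bool.Properties
  using (∧-distribˡ-xor; ∧-distribʳ-xor; ∧-zeroʳ; ∧-identityʳ; ∧-assoc; ∧-comm; ∨-zeroʳ;
         ∨-identityʳ; T-≡; ¬-not; xor-∧-commutativeRing; xor-same; xor-comm; xor-assoc;
         xor-identityʳ; not-involutive; ⇔→≡)
open import Data.Empty using (⊥; ⊥-elim)
open import Data.List
  using (List; []; _∷_; map; _++_; length; filter; cartesianProduct; applyUpTo)
open import Data.List.Properties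
  using (length-map; map-∘; map-++; ++-identityʳ; ++-assoc; cartesianProductWith-distribʳ-++;
         cartesianProductWith-zeroʳ)
open import Data.List.Membership.Propositional using (_∈_)
open import Data.List.Membership.Propositional.Properties
  using (∈-++⁺ˡ; ∈-++⁺ʳ; ∈-++⁻; ∈-filter⁻; ∈-cartesianProduct⁻; ∈-map⁺; ∈-map⁻)
open import Data.List.Relation.Unary.All as All using (_∷_)
open import Data.List.Relation.Unary.AllPairs using ([]; _∷_)
open import Data.List.Relation.Unary.Any using (here; there)
open import Data.List.Relation.Unary.Unique.Propositional using (Unique)
open import Data.List.Relation.Unary.Unique.Propositional.Properties using (cartesianProduct⁺; upTo⁺)
open import Data.List.Relation.Binary.Permutation.Propositional
  using (_↭_; refl; prep; swap; trans; ↭-sym; ↭-reflexive; ↭⇒↭ₛ)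
open import Data.List.Relation.Binary.Permutation.Propositional.Properties
  using (↭-length; ∈-resp-↭; ++⁺ˡ; ++⁺ʳ; shift; shifts; map⁺; ++-comm)
import Data.List.Relation.Binary.Permutation.Setoid.Properties as SetoidPermutation
open import Data.Maybe as Maybe using (Maybe; nothing; just)
open import Data.Nat
  using (ℕ; zero; suc; _+_; _*_; _∸_; _%_; _/_; _≡ᵇ_; _≤ᵇ_; _<ᵇ_; _≤_; _<_; s≤s; z≤n; less;
         equal; greater; compare)
open import Data.Nat.Coprimality as Coprimality
  using (Coprime; coprime-+; coprime-factors; coprime⇒gcd≡1; gcd≡1⇒coprime)
open import Data.Nat.Divisibility
  using (_∣_; divides; ∣m∣n⇒∣m+n; ∣m⇒∣m*n; ∣-refl; ∣⇒≤; 0∣⇒≡0; n∣m*n)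
open import Data.Nat.DivMod using (m≡m%n+[m/n]*n; [m+kn]%n≡m%n)
open import Data.Nat.GCD using (gcd; c*gcd[m,n]≡gcd[cm,cn])
open import Data.Nat.Properties
  using (*-assoc; *-cancelˡ-≡; *-comm; +-assoc; +-cancelʳ-≡; +-cancelˡ-<; +-cancelˡ-≡;
         +-comm; +-identityʳ; +-mono-≤; +-monoʳ-≤; +-monoˡ-≤; +-suc; 1+n≢0; 1+n≢n; <-asym;
         <-trans; <-≤-trans; <ᵇ⇒<; <⇒<ᵇ; <⇒≢; <⇒≤; <⇒≱; >⇒≢; m+1+n≢m; m+[n∸m]≡n; m+n∸m≡n;
         m+n∸n≡m; m<m+n; m<n⇒m<1+n; m≤m+n; m≤n+m; m≤n⇒m<n∨m≡n; m≤n⇒m∸n≡0; m≤n⇒∃[o]m+o≡n;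
         n<1+n; n∸n≡0; n≤1+n; suc-injective; ≡ᵇ⇒≡; ≤-<-trans; ≤-antisym; ≤-pred; ≤-refl;
         ≤-reflexive; ≤-trans; ≤∧≢⇒<; _≟_)
open import Data.Product as Product using (_×_; _,_; proj₁; proj₂; ∃; map₁)
open import Data.Sum using (_⊎_; inj₁; inj₂)
open import Function using (_∘_; id)
open import Function.Bundles using (_⇔_; mk⇔; Equivalence)
open import Relation.Nullary using (yes; no)
open import Relation.Nullary.Decidable using (T?)
open import Relation.Binary.PropositionalEquality
  using (_≡_; _≢_; refl; sym; cong; cong₂; subst; setoid; module ≡-Reasoning)
  renaming (trans to ≡-trans)
open ≡-Reasoning

-- Modulo 2 no signs occur: determinant and Pfaffian are plain sums over bijections and over
-- matchings, both given by expansion along a first row. The sum of a vertex and its mirror image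
-- pairs to zero with every other such sum, with the middle row and with the apex. It can be matched
-- only to a mirror image, which is why a determinant of one half splits off.
--
-- The sets S come from the ring F[x]/(U_m), F the field with two elements. In its basis e_j =
-- U_(j-1), 1 ≤ j ≤ m, multiplication by x is the adjacency matrix P of the path with m vertices, so
-- the solution started at e_i has the j-th row U_(j-1)(P) e_i = e_j e_i. The coefficients of such
-- products are given by truncated triangle inequalities and a parity condition, and the row after
-- the last vanishes because U_m = 0: the solution fits into m rows.
--
-- The two factors treat r and c differently. That (c + 1) / 2 is odd means that c is 1 mod 4,
-- whereas the condition on r mod 4 is hidden in the determinant: s + 1 must be coprime to the even
-- number c + 1.

private
  variable
    X Y Z W : Set

open CommutativeRing xor-∧-commutativeRing
  using (*-commutativeSemigroup; +-commutativeMonoid)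
open CommutativeSemigroupProperties (CommutativeMonoid.commutativeSemigroup +-commutativeMonoid)
  using () renaming (interchange to xor-interchange; x∙yz≈y∙xz to xor-swap)
open CommutativeSemigroupProperties *-commutativeSemigroup
  using () renaming (x∙yz≈y∙xz to ∧-swap)

-- Sums modulo 2 over the choice of an element of a list.

-- Each element is passed on together with the remaining ones: the shape of an expansion along a
-- row, for determinants and Pfaffians alike.
sumPicks : List X → (X → List X → Bool) → Bool
sumPicks []       f = false
sumPicks (x ∷ xs) f = f x xs xor sumPicks xs (λ y ys → f y (x ∷ ys))

private
  pick-there : ∀ {x y : X} {xs ys} → y ∷ ys ↭ xs → y ∷ x ∷ ys ↭ x ∷ xs
  pick-there {x = x} {y} p = trans (swap y x refl) (prep x p)

-- The permutation handed to the premise records where `y` and `ys` come from. It supplies the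
-- membership facts for entries and the length bounds for recursion.
sumPicks-cong : ∀ (xs : List X) {f g} →
  (∀ y ys → y ∷ ys ↭ xs → f y ys ≡ g y ys) → sumPicks xs f ≡ sumPicks xs g
sumPicks-cong []       eq = refl
sumPicks-cong (x ∷ xs) eq =
  cong₂ _xor_ (eq x xs refl) (sumPicks-cong xs (λ y ys p → eq y (x ∷ ys) (pick-there p)))

sumPicks-false : ∀ (xs : List X) {f} →
  (∀ y ys → y ∷ ys ↭ xs → f y ys ≡ false) → sumPicks xs f ≡ false
sumPicks-false []       eq = refl
sumPicks-false (x ∷ xs) eq =
  cong₂ _xor_ (eq x xs refl) (sumPicks-false xs (λ y ys p → eq y (x ∷ ys) (pick-there p)))

sumPicks-xor : ∀ (xs : List X) (f g : X → List X → Bool) →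
  sumPicks xs (λ y ys → f y ys xor g y ys) ≡ sumPicks xs f xor sumPicks xs g
sumPicks-xor []       f g = refl
sumPicks-xor (x ∷ xs) f g =
  ≡-trans (cong ((f x xs xor g x xs) xor_) (sumPicks-xor xs _ _))
          (xor-interchange (f x xs) (g x xs) _ _)

sumPicks-∧ʳ : ∀ (xs : List X) (f : X → List X → Bool) b →
  sumPicks xs (λ y ys → f y ys ∧ b) ≡ sumPicks xs f ∧ b
sumPicks-∧ʳ []       f b = refl
sumPicks-∧ʳ (x ∷ xs) f b =
  ≡-trans (cong (f x xs ∧ b xor_) (sumPicks-∧ʳ xs _ b)) (sym (∧-distribʳ-xor b (f x xs) _))

sumPicks-∧ˡ : ∀ (xs : List X) (f : X → List X → Bool) b →
  sumPicks xs (λ y ys → b ∧ f y ys) ≡ b ∧ sumPicks xs f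
sumPicks-∧ˡ xs f true  = refl
sumPicks-∧ˡ xs f false = sumPicks-false xs (λ _ _ _ → refl)

sumPicks-map : ∀ (p : X → Y) xs f →
  sumPicks (map p xs) f ≡ sumPicks xs (λ y ys → f (p y) (map p ys))
sumPicks-map p []       f = refl
sumPicks-map p (x ∷ xs) f = cong (f (p x) (map p xs) xor_) (sumPicks-map p xs _)

sumPicks-++ : ∀ (xs ys : List X) f → sumPicks (xs ++ ys) f ≡
  sumPicks xs (λ z zs → f z (zs ++ ys)) xor sumPicks ys (λ z zs → f z (xs ++ zs))
sumPicks-++ []       ys f = refl
sumPicks-++ (x ∷ xs) ys f =
  ≡-trans (cong (f x (xs ++ ys) xor_) (sumPicks-++ xs ys _)) (sym (xor-assoc (f x (xs ++ ys)) _ _))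

-- Permuting the list also permutes the remainders given to `f`, hence the condition that `f` does
-- not see the order of its second argument.
sumPicks-↭ : ∀ {xs xs′ : List X} {f} → xs ↭ xs′ →
  (∀ y {ys zs} → y ∷ ys ↭ xs → ys ↭ zs → f y ys ≡ f y zs) →
  sumPicks xs f ≡ sumPicks xs′ f
sumPicks-↭ refl resp = refl
sumPicks-↭ (prep x p) resp =
  cong₂ _xor_ (resp x refl p) (sumPicks-↭ p (λ y q r → resp y (pick-there q) (prep x r)))
sumPicks-↭ {xs = _ ∷ _ ∷ xs} {f = f} (swap {ys = xs′} x y p) resp = begin
  f x (y ∷ xs) xor (f y (x ∷ xs) xor sumPicks xs (λ z zs → f z (x ∷ y ∷ zs)))
    ≡⟨ xor-assoc (f x (y ∷ xs)) _ _ ⟨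
  (f x (y ∷ xs) xor f y (x ∷ xs)) xor sumPicks xs (λ z zs → f z (x ∷ y ∷ zs))
    ≡⟨ cong₂ _xor_
         (≡-trans (xor-comm (f x (y ∷ xs)) _)
           (cong₂ _xor_ (resp y (swap y x refl) (prep x p)) (resp x refl (prep y p))))
         (≡-trans
           (sumPicks-↭ p (λ z q r → resp z (trans (pick-there (pick-there q)) refl) (prep x (prep y r))))
           (sumPicks-cong xs′ (λ z zs q → resp z
             (trans (pick-there (pick-there q)) (prep x (prep y (↭-sym p)))) (swap x y refl)))) ⟩
  (f y (x ∷ xs′) xor f x (y ∷ xs′)) xor sumPicks xs′ (λ z zs → f z (y ∷ x ∷ zs))
    ≡⟨ xor-assoc (f y (x ∷ xs′)) _ _ ⟩
  f y (x ∷ xs′) xor (f x (y ∷ xs′) xor sumPicks xs′ (λ z zs → f z (y ∷ x ∷ zs))) ∎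
sumPicks-↭ (trans p q) resp =
  ≡-trans (sumPicks-↭ p resp) (sumPicks-↭ q (λ y r s → resp y (trans r (↭-sym p)) s))

sumPairs-comm : ∀ (xs : List X) (f : X → X → List X → Bool) →
  sumPicks xs (λ y ys → sumPicks ys (λ z zs → f y z zs)) ≡
  sumPicks xs (λ y ys → sumPicks ys (λ z zs → f z y zs))
sumPairs-comm []       f = refl
sumPairs-comm (x ∷ xs) f = begin
  sumPicks xs (f x) xor
    sumPicks xs (λ y ys → f y x ys xor sumPicks ys (λ z zs → f y z (x ∷ zs)))
    ≡⟨ cong (sumPicks xs (f x) xor_) (sumPicks-xor xs (λ y ys → f y x ys) _) ⟩
  sumPicks xs (f x) xor (sumPicks xs (λ y ys → f y x ys) xor
    sumPicks xs (λ y ys → sumPicks ys (λ z zs → f y z (x ∷ zs))))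
    ≡⟨ xor-swap (sumPicks xs (f x)) (sumPicks xs (λ y ys → f y x ys)) _ ⟩
  sumPicks xs (λ y ys → f y x ys) xor (sumPicks xs (f x) xor
    sumPicks xs (λ y ys → sumPicks ys (λ z zs → f y z (x ∷ zs))))
    ≡⟨ cong (λ b → sumPicks xs (λ y ys → f y x ys) xor (sumPicks xs (f x) xor b))
         (sumPairs-comm xs (λ y z zs → f y z (x ∷ zs))) ⟩
  sumPicks xs (λ y ys → f y x ys) xor (sumPicks xs (f x) xor
    sumPicks xs (λ y ys → sumPicks ys (λ z zs → f z y (x ∷ zs))))
    ≡⟨ cong (sumPicks xs (λ y ys → f y x ys) xor_) (sumPicks-xor xs (f x) _) ⟨
  sumPicks xs (λ y ys → f y x ys) xor
    sumPicks xs (λ y ys → f x y ys xor sumPicks ys (λ z zs → f z y (x ∷ zs))) ∎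

-- Each pair of positions is visited in both orders with the same remainder, and equal terms cancel
-- modulo 2.
sumPairs-symmetric : ∀ (xs : List X) (f : X → X → List X → Bool) →
  (∀ y z zs → f y z zs ≡ f z y zs) →
  sumPicks xs (λ y ys → sumPicks ys (λ z zs → f y z zs)) ≡ false
sumPairs-symmetric []       f f-sym = refl
sumPairs-symmetric (x ∷ xs) f f-sym = begin
  sumPicks xs (f x) xor
    sumPicks xs (λ y ys → f y x ys xor sumPicks ys (λ z zs → f y z (x ∷ zs)))
    ≡⟨ cong (sumPicks xs (f x) xor_) (sumPicks-xor xs (λ y ys → f y x ys) _) ⟩
  sumPicks xs (f x) xor (sumPicks xs (λ y ys → f y x ys) xor
    sumPicks xs (λ y ys → sumPicks ys (λ z zs → f y z (x ∷ zs))))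
    ≡⟨ cong₂ (λ a b → sumPicks xs (f x) xor (a xor b))
         (sumPicks-cong xs (λ y ys _ → f-sym y x ys))
         (sumPairs-symmetric xs _ (λ y z zs → f-sym y z (x ∷ zs))) ⟩
  sumPicks xs (f x) xor (sumPicks xs (f x) xor false)
    ≡⟨ cong (sumPicks xs (f x) xor_) (xor-identityʳ _) ⟩
  sumPicks xs (f x) xor sumPicks xs (f x)
    ≡⟨ xor-same (sumPicks xs (f x)) ⟩
  false ∎

∈⇒↭∷ : ∀ {x : X} {xs} → x ∈ xs → ∃ λ ys → xs ↭ x ∷ ys
∈⇒↭∷ {xs = _ ∷ xs} (here refl) = xs , refl
∈⇒↭∷ {xs = y ∷ xs} (there x∈xs) with ∈⇒↭∷ x∈xs
... | ys , p = y ∷ ys , trans (prep y p) (swap y _ refl)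

-- Determinants and Pfaffians over the field with two elements

-- Rows and columns are separate lists because the pivots remove rows and columns with different
-- indices. Lists of different lengths give `false`.
Det : (X → Y → Bool) → List X → List Y → Bool
Det A []       []      = true
Det A []       (_ ∷ _) = false
Det A (x ∷ xs) ys      = sumPicks ys (λ y ys′ → A x y ∧ Det A xs ys′)

Det-cong : ∀ {A B : X → Y → Bool} xs ys →
  (∀ {x y} → x ∈ xs → y ∈ ys → A x y ≡ B x y) → Det A xs ys ≡ Det B xs ys
Det-cong []       []      eq = refl
Det-cong []       (_ ∷ _) eq = refl
Det-cong (x ∷ xs) ys      eq = sumPicks-cong ys λ y ys′ p →
  cong₂ _∧_ (eq (here refl) (∈-resp-↭ p (here refl)))
    (Det-cong xs ys′ (λ x∈ y∈ → eq (there x∈) (∈-resp-↭ p (there y∈))))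

Det-map : ∀ (A : Z → W → Bool) (p : X → Z) (q : Y → W) xs ys →
  Det A (map p xs) (map q ys) ≡ Det (λ x y → A (p x) (q y)) xs ys
Det-map A p q []       []      = refl
Det-map A p q []       (_ ∷ _) = refl
Det-map A p q (x ∷ xs) ys      = ≡-trans (sumPicks-map q ys _)
  (sumPicks-cong ys (λ y ys′ _ → cong (A (p x) (q y) ∧_) (Det-map A p q xs ys′)))

Det-↭ʳ : ∀ (A : X → Y → Bool) xs {ys ys′} → ys ↭ ys′ → Det A xs ys ≡ Det A xs ys′
Det-↭ʳ A [] {[]}    {[]}    p = refl
Det-↭ʳ A [] {[]}    {_ ∷ _} p with () ← ↭-length p
Det-↭ʳ A [] {_ ∷ _} {[]}    p with () ← ↭-length p
Det-↭ʳ A [] {_ ∷ _} {_ ∷ _} p = refl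
Det-↭ʳ A (x ∷ xs) p = sumPicks-↭ p (λ y _ q → cong (A x y ∧_) (Det-↭ʳ A xs q))

Det-∷∷ : ∀ (A : X → Y → Bool) x x′ xs ys → Det A (x ∷ x′ ∷ xs) ys ≡
  sumPicks ys (λ y ys′ → sumPicks ys′ (λ z zs → A x y ∧ (A x′ z ∧ Det A xs zs)))
Det-∷∷ A x x′ xs ys = sumPicks-cong ys (λ y ys′ _ → sym (sumPicks-∧ˡ ys′ _ (A x y)))

-- Exchanging two rows exchanges the roles of the two chosen columns in the double expansion, which
-- runs over all ordered pairs of columns.
Det-↭ˡ : ∀ (A : X → Y → Bool) {xs xs′} ys → xs ↭ xs′ → Det A xs ys ≡ Det A xs′ ys
Det-↭ˡ A ys refl = refl
Det-↭ˡ A ys (prep x p) = sumPicks-cong ys (λ y ys′ _ → cong (A x y ∧_) (Det-↭ˡ A ys′ p))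
Det-↭ˡ A {_ ∷ _ ∷ xs} ys (swap {ys = xs′} x x′ p) = begin
  Det A (x ∷ x′ ∷ xs) ys
    ≡⟨ Det-∷∷ A x x′ xs ys ⟩
  sumPicks ys (λ y ys′ → sumPicks ys′ (λ z zs → A x y ∧ (A x′ z ∧ Det A xs zs)))
    ≡⟨ sumPairs-comm ys (λ y z zs → A x y ∧ (A x′ z ∧ Det A xs zs)) ⟩
  sumPicks ys (λ y ys′ → sumPicks ys′ (λ z zs → A x z ∧ (A x′ y ∧ Det A xs zs)))
    ≡⟨ sumPicks-cong ys (λ y ys′ _ → sumPicks-cong ys′ (λ z zs _ →
         ≡-trans (∧-swap (A x z) (A x′ y) _)
                 (cong (λ b → A x′ y ∧ (A x z ∧ b)) (Det-↭ˡ A zs p)))) ⟩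
  sumPicks ys (λ y ys′ → sumPicks ys′ (λ z zs → A x′ y ∧ (A x z ∧ Det A xs′ zs)))
    ≡⟨ Det-∷∷ A x′ x xs′ ys ⟨
  Det A (x′ ∷ x ∷ xs′) ys ∎
Det-↭ˡ A ys (trans p q) = ≡-trans (Det-↭ˡ A ys p) (Det-↭ˡ A ys q)

Det-repeated-row : ∀ (A : X → Y → Bool) {x xs} ys → x ∈ xs → Det A (x ∷ xs) ys ≡ false
Det-repeated-row A {x} {xs} ys x∈xs with ∈⇒↭∷ x∈xs
... | xs′ , p = begin
  Det A (x ∷ xs) ys       ≡⟨ Det-↭ˡ A ys (prep x p) ⟩
  Det A (x ∷ x ∷ xs′) ys  ≡⟨ Det-∷∷ A x x xs′ ys ⟩
  sumPicks ys (λ y ys′ → sumPicks ys′ (λ z zs → A x y ∧ (A x z ∧ Det A xs′ zs)))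
    ≡⟨ sumPairs-symmetric ys _ (λ y z zs → ∧-swap (A x y) (A x z) _) ⟩
  false ∎

-- The rows `xs` vanish on `ys′` and therefore use up columns of `ys`; as the lengths agree, exactly
-- `ys′` is left for `xs′`.
Det-++ : ∀ (A : X → Y → Bool) xs xs′ ys ys′ → length xs ≡ length ys →
  (∀ {x y} → x ∈ xs → y ∈ ys′ → A x y ≡ false) →
  Det A (xs ++ xs′) (ys ++ ys′) ≡ Det A xs ys ∧ Det A xs′ ys′
Det-++ A []       xs′ []      ys′ len zero-block = refl
Det-++ A (x ∷ xs) xs′ ys ys′ len zero-block = begin
  sumPicks (ys ++ ys′) (λ y zs → A x y ∧ Det A (xs ++ xs′) zs)
    ≡⟨ sumPicks-++ ys ys′ _ ⟩
  sumPicks ys (λ y zs → A x y ∧ Det A (xs ++ xs′) (zs ++ ys′)) xor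
    sumPicks ys′ (λ y zs → A x y ∧ Det A (xs ++ xs′) (ys ++ zs))
    ≡⟨ cong₂ _xor_
         (sumPicks-cong ys (λ y zs p → ≡-trans
           (cong (A x y ∧_) (Det-++ A xs xs′ zs ys′ (suc-injective (≡-trans len (sym (↭-length p))))
             (λ x∈ y∈ → zero-block (there x∈) y∈)))
           (sym (∧-assoc (A x y) _ _))))
         (sumPicks-false ys′ (λ y zs p →
           cong (_∧ Det A (xs ++ xs′) (ys ++ zs)) (zero-block (here refl) (∈-resp-↭ p (here refl))))) ⟩
  sumPicks ys (λ y zs → (A x y ∧ Det A xs zs) ∧ Det A xs′ ys′) xor false
    ≡⟨ xor-identityʳ _ ⟩
  sumPicks ys (λ y zs → (A x y ∧ Det A xs zs) ∧ Det A xs′ ys′)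
    ≡⟨ sumPicks-∧ʳ ys _ (Det A xs′ ys′) ⟩
  Det A (x ∷ xs) ys ∧ Det A xs′ ys′ ∎

sum : List X → (X → Bool) → Bool
sum []       f = false
sum (x ∷ xs) f = f x xor sum xs f

-- Adding the row of `s` changes the expansion by a determinant in which `s` occurs twice. The
-- result stays expanded because the new first row is in general not a row of `A`.
Det-row-op : ∀ (A : X → Y → Bool) (f : X → Bool) x xs ss ys → (∀ {s} → s ∈ ss → s ∈ xs) →
  Det A (x ∷ xs) ys ≡
  sumPicks ys (λ y ys′ → (A x y xor sum ss (λ s → f s ∧ A s y)) ∧ Det A xs ys′)
Det-row-op A f x xs [] ys ss⊆xs =
  sumPicks-cong ys (λ y ys′ _ → cong (_∧ Det A xs ys′) (sym (xor-identityʳ (A x y))))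
Det-row-op A f x xs (s ∷ ss) ys ss⊆xs = begin
  Det A (x ∷ xs) ys
    ≡⟨ Det-row-op A f x xs ss ys (ss⊆xs ∘ there) ⟩
  sumPicks ys (λ y ys′ → (A x y xor sum ss (λ s → f s ∧ A s y)) ∧ Det A xs ys′)
    ≡⟨ xor-identityʳ _ ⟨
  sumPicks ys (λ y ys′ → (A x y xor sum ss (λ s → f s ∧ A s y)) ∧ Det A xs ys′) xor false
    ≡⟨ cong (sumPicks ys _ xor_) extra ⟨
  sumPicks ys (λ y ys′ → (A x y xor sum ss (λ s → f s ∧ A s y)) ∧ Det A xs ys′) xor
    sumPicks ys (λ y ys′ → f s ∧ (A s y ∧ Det A xs ys′))
    ≡⟨ sumPicks-xor ys _ _ ⟨
  sumPicks ys (λ y ys′ → ((A x y xor sum ss (λ s → f s ∧ A s y)) ∧ Det A xs ys′) xor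
    (f s ∧ (A s y ∧ Det A xs ys′)))
    ≡⟨ sumPicks-cong ys (λ y ys′ _ →
         lemma (A x y) (f s) (A s y) (sum ss (λ s → f s ∧ A s y)) (Det A xs ys′)) ⟩
  sumPicks ys (λ y ys′ → (A x y xor sum (s ∷ ss) (λ s → f s ∧ A s y)) ∧ Det A xs ys′) ∎
  where
  extra : sumPicks ys (λ y ys′ → f s ∧ (A s y ∧ Det A xs ys′)) ≡ false
  extra = ≡-trans (sumPicks-∧ˡ ys _ (f s))
    (≡-trans (cong (f s ∧_) (Det-repeated-row A ys (ss⊆xs (here refl)))) (∧-zeroʳ (f s)))
  lemma : ∀ a b c d e → ((a xor d) ∧ e) xor (b ∧ (c ∧ e)) ≡ (a xor ((b ∧ c) xor d)) ∧ e
  lemma a b c d e = begin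
    ((a xor d) ∧ e) xor (b ∧ (c ∧ e)) ≡⟨ cong (((a xor d) ∧ e) xor_) (∧-assoc b c e) ⟨
    ((a xor d) ∧ e) xor ((b ∧ c) ∧ e) ≡⟨ ∧-distribʳ-xor e (a xor d) (b ∧ c) ⟨
    ((a xor d) xor (b ∧ c)) ∧ e       ≡⟨ cong (_∧ e) (xor-assoc a d (b ∧ c)) ⟩
    (a xor (d xor (b ∧ c))) ∧ e       ≡⟨ cong (λ z → (a xor z) ∧ e) (xor-comm d (b ∧ c)) ⟩
    (a xor ((b ∧ c) xor d)) ∧ e ∎

Det-dependent-row : ∀ (A : X → Y → Bool) (f : X → Bool) x xs ss ys → (∀ {s} → s ∈ ss → s ∈ xs) →
  (∀ {y} → y ∈ ys → A x y xor sum ss (λ s → f s ∧ A s y) ≡ false) →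
  Det A (x ∷ xs) ys ≡ false
Det-dependent-row A f x xs ss ys ss⊆xs dep = ≡-trans (Det-row-op A f x xs ss ys ss⊆xs)
  (sumPicks-false ys (λ y ys′ p → cong (_∧ _) (dep (∈-resp-↭ p (here refl)))))

-- The row operation turns the first row into the unit vector of column `y`, so a single term of its
-- expansion survives.
Det-pivot : ∀ (A : X → Y → Bool) (f : X → Bool) x xs ss y ys → (∀ {s} → s ∈ ss → s ∈ xs) →
  A x y xor sum ss (λ s → f s ∧ A s y) ≡ true →
  (∀ {z} → z ∈ ys → A x z xor sum ss (λ s → f s ∧ A s z) ≡ false) →
  Det A (x ∷ xs) (y ∷ ys) ≡ Det A xs ys
Det-pivot A f x xs ss y ys ss⊆xs one zeros = begin
  Det A (x ∷ xs) (y ∷ ys)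
    ≡⟨ Det-row-op A f x xs ss (y ∷ ys) ss⊆xs ⟩
  ((A x y xor sum ss (λ s → f s ∧ A s y)) ∧ Det A xs ys) xor
    sumPicks ys (λ z zs → (A x z xor sum ss (λ s → f s ∧ A s z)) ∧ Det A xs (y ∷ zs))
    ≡⟨ cong₂ _xor_ (cong (_∧ Det A xs ys) one)
         (sumPicks-false ys (λ z zs p → cong (_∧ _) (zeros (∈-resp-↭ p (here refl))))) ⟩
  Det A xs ys xor false
    ≡⟨ xor-identityʳ _ ⟩
  Det A xs ys ∎

private
  -- The first argument is fuel.
  pf : ℕ → (X → X → Bool) → List X → Bool
  pf _       A []       = true
  pf zero    A (_ ∷ _)  = false
  pf (suc n) A (x ∷ xs) = sumPicks xs (λ y ys → A x y ∧ pf n A ys)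

  pick-≤ : ∀ {y : X} {xs ys n} → y ∷ ys ↭ xs → length xs ≤ n → length ys ≤ n
  pick-≤ p le = ≤-trans (n≤1+n _) (≤-trans (≤-reflexive (↭-length p)) le)

  pf-fuel : ∀ m n (A : X → X → Bool) xs → length xs ≤ m → length xs ≤ n → pf m A xs ≡ pf n A xs
  pf-fuel m n A [] _ _ = refl
  pf-fuel (suc m) (suc n) A (x ∷ xs) (s≤s l) (s≤s l′) = sumPicks-cong xs (λ y ys p →
    cong (A x y ∧_) (pf-fuel m n A ys (pick-≤ p l) (pick-≤ p l′)))

Pf : (X → X → Bool) → List X → Bool
Pf A xs = pf (length xs) A xs

-- All amounts of fuel that are at least the length agree, so each remainder can be given its own
-- length again.
Pf-∷ : ∀ (A : X → X → Bool) x xs → Pf A (x ∷ xs) ≡ sumPicks xs (λ y ys → A x y ∧ Pf A ys)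
Pf-∷ A x xs = sumPicks-cong xs (λ y ys p →
  cong (A x y ∧_) (pf-fuel _ _ A ys (pick-≤ p ≤-refl) ≤-refl))

Pf-∷∷ : ∀ (A : X → X → Bool) x y xs → Pf A (x ∷ y ∷ xs) ≡
  (A x y ∧ Pf A xs) xor
  sumPicks xs (λ z zs → sumPicks zs (λ w ws → A x z ∧ (A y w ∧ Pf A ws)))
Pf-∷∷ A x y xs = ≡-trans (Pf-∷ A x (y ∷ xs)) (cong ((A x y ∧ Pf A xs) xor_)
  (sumPicks-cong xs (λ z zs _ → ≡-trans (cong (A x z ∧_) (Pf-∷ A y zs))
    (sym (sumPicks-∧ˡ zs _ (A x z))))))

private
  Pf-cong-≤ : ∀ n {A B : X → X → Bool} xs → length xs ≤ n →
    (∀ {x y} → x ∈ xs → y ∈ xs → A x y ≡ B x y) → Pf A xs ≡ Pf B xs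
  Pf-cong-≤ n []       le eq = refl
  Pf-cong-≤ (suc n) {A} {B} (x ∷ xs) (s≤s le) eq = begin
    Pf A (x ∷ xs)                            ≡⟨ Pf-∷ A x xs ⟩
    sumPicks xs (λ y ys → A x y ∧ Pf A ys)
      ≡⟨ sumPicks-cong xs (λ y ys p → cong₂ _∧_
           (eq (here refl) (there (∈-resp-↭ p (here refl))))
           (Pf-cong-≤ n ys (pick-≤ p le)
             (λ a b → eq (there (∈-resp-↭ p (there a))) (there (∈-resp-↭ p (there b)))))) ⟩
    sumPicks xs (λ y ys → B x y ∧ Pf B ys)   ≡⟨ Pf-∷ B x xs ⟨
    Pf B (x ∷ xs) ∎

  Pf-map-≤ : ∀ n (A : Y → Y → Bool) (p : X → Y) xs → length xs ≤ n →
    Pf A (map p xs) ≡ Pf (λ x y → A (p x) (p y)) xs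
  Pf-map-≤ n A p [] le = refl
  Pf-map-≤ (suc n) A p (x ∷ xs) (s≤s le) = begin
    Pf A (p x ∷ map p xs)                                     ≡⟨ Pf-∷ A (p x) (map p xs) ⟩
    sumPicks (map p xs) (λ y ys → A (p x) y ∧ Pf A ys)        ≡⟨ sumPicks-map p xs _ ⟩
    sumPicks xs (λ y ys → A (p x) (p y) ∧ Pf A (map p ys))
      ≡⟨ sumPicks-cong xs (λ y ys q → cong (A (p x) (p y) ∧_) (Pf-map-≤ n A p ys (pick-≤ q le))) ⟩
    sumPicks xs (λ y ys → A (p x) (p y) ∧ Pf (λ x y → A (p x) (p y)) ys)
      ≡⟨ Pf-∷ _ x xs ⟨
    Pf (λ x y → A (p x) (p y)) (x ∷ xs) ∎

Pf-cong : ∀ {A B : X → X → Bool} xs →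
  (∀ {x y} → x ∈ xs → y ∈ xs → A x y ≡ B x y) → Pf A xs ≡ Pf B xs
Pf-cong xs = Pf-cong-≤ (length xs) xs ≤-refl

Pf-map : ∀ (A : Y → Y → Bool) (p : X → Y) xs → Pf A (map p xs) ≡ Pf (λ x y → A (p x) (p y)) xs
Pf-map A p xs = Pf-map-≤ (length xs) A p xs ≤-refl

module Pfaffian (A : X → X → Bool) (A-sym : ∀ x y → A x y ≡ A y x) where

  private
    -- The symmetry of `A` enters in the swap case: in the double expansion either the two first
    -- elements are matched together or their partners trade places. The bound `n` drives the
    -- recursion, since remainders of an expansion are not subterms.
    Pf-↭-≤ : ∀ n {xs ys} → length xs ≤ n → xs ↭ ys → Pf A xs ≡ Pf A ys
    Pf-↭-≤ n le refl = refl
    Pf-↭-≤ (suc n) (s≤s le) (prep {xs} {ys} x p) = begin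
      Pf A (x ∷ xs)                            ≡⟨ Pf-∷ A x xs ⟩
      sumPicks xs (λ y ys → A x y ∧ Pf A ys)
        ≡⟨ sumPicks-↭ p (λ y q r → cong (A x y ∧_) (Pf-↭-≤ n (pick-≤ q le) r)) ⟩
      sumPicks ys (λ y ys → A x y ∧ Pf A ys)   ≡⟨ Pf-∷ A x ys ⟨
      Pf A (x ∷ ys) ∎
    Pf-↭-≤ (suc n) (s≤s le) (swap {xs} {ys} x y p) = begin
      Pf A (x ∷ y ∷ xs)
        ≡⟨ Pf-∷∷ A x y xs ⟩
      (A x y ∧ Pf A xs) xor
      sumPicks xs (λ z zs → sumPicks zs (λ w ws → A x z ∧ (A y w ∧ Pf A ws)))
        ≡⟨ cong₂ _xor_ (cong (_∧ Pf A xs) (A-sym x y))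
             (≡-trans (sumPairs-comm xs (λ z w ws → A x z ∧ (A y w ∧ Pf A ws)))
               (sumPicks-cong xs (λ z zs _ → sumPicks-cong zs (λ w ws _ →
                 ∧-swap (A x w) (A y z) (Pf A ws))))) ⟩
      (A y x ∧ Pf A xs) xor
      sumPicks xs (λ z zs → sumPicks zs (λ w ws → A y z ∧ (A x w ∧ Pf A ws)))
        ≡⟨ Pf-∷∷ A y x xs ⟨
      Pf A (y ∷ x ∷ xs)
        ≡⟨ Pf-∷ A y (x ∷ xs) ⟩
      sumPicks (x ∷ xs) (λ z zs → A y z ∧ Pf A zs)
        ≡⟨ sumPicks-↭ (prep x p) (λ z q r → cong (A y z ∧_) (Pf-↭-≤ n (pick-≤ q le) r)) ⟩
      sumPicks (x ∷ ys) (λ z zs → A y z ∧ Pf A zs)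
        ≡⟨ Pf-∷ A y (x ∷ ys) ⟨
      Pf A (y ∷ x ∷ ys) ∎
    Pf-↭-≤ n le (trans p q) = ≡-trans (Pf-↭-≤ n le p)
      (Pf-↭-≤ n (≤-trans (≤-reflexive (sym (↭-length p))) le) q)

  Pf-↭ : ∀ {xs ys} → xs ↭ ys → Pf A xs ≡ Pf A ys
  Pf-↭ = Pf-↭-≤ _ ≤-refl

  module Alternating (A-loopless : ∀ x → A x x ≡ false) where

    -- The two copies cannot be matched together, and trading their partners pairs off all other
    -- terms.
    Pf-repeated : ∀ {x xs} → x ∈ xs → Pf A (x ∷ xs) ≡ false
    Pf-repeated {x} {xs} x∈xs with ∈⇒↭∷ x∈xs
    ... | ys , p = begin
      Pf A (x ∷ xs)      ≡⟨ Pf-↭ (prep x p) ⟩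
      Pf A (x ∷ x ∷ ys)  ≡⟨ Pf-∷∷ A x x ys ⟩
      (A x x ∧ Pf A ys) xor
      sumPicks ys (λ z zs → sumPicks zs (λ w ws → A x z ∧ (A x w ∧ Pf A ws)))
        ≡⟨ cong₂ _xor_ (cong (_∧ Pf A ys) (A-loopless x))
             (sumPairs-symmetric ys _ (λ z w ws → ∧-swap (A x z) (A x w) _)) ⟩
      false ∎

    -- `z` plays the part of `x + x′`. By linearity in the first row the difference is a Pfaffian in
    -- which `x′` occurs twice.
    Pf-add : ∀ {x x′ z xs} → x′ ∈ xs → (∀ y → A z y ≡ A x y xor A x′ y) →
      Pf A (x ∷ xs) ≡ Pf A (z ∷ xs)
    Pf-add {x} {x′} {z} {xs} x′∈xs eq = begin
      Pf A (x ∷ xs)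
        ≡⟨ xor-identityʳ _ ⟨
      Pf A (x ∷ xs) xor false
        ≡⟨ cong (Pf A (x ∷ xs) xor_) (Pf-repeated x′∈xs) ⟨
      Pf A (x ∷ xs) xor Pf A (x′ ∷ xs)
        ≡⟨ cong₂ _xor_ (Pf-∷ A x xs) (Pf-∷ A x′ xs) ⟩
      sumPicks xs (λ y ys → A x y ∧ Pf A ys) xor sumPicks xs (λ y ys → A x′ y ∧ Pf A ys)
        ≡⟨ sumPicks-xor xs _ _ ⟨
      sumPicks xs (λ y ys → (A x y ∧ Pf A ys) xor (A x′ y ∧ Pf A ys))
        ≡⟨ sumPicks-cong xs (λ y ys _ → ≡-trans
             (sym (∧-distribʳ-xor (Pf A ys) (A x y) (A x′ y)))
             (cong (_∧ Pf A ys) (sym (eq y)))) ⟩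
      sumPicks xs (λ y ys → A z y ∧ Pf A ys)
        ≡⟨ Pf-∷ A z xs ⟨
      Pf A (z ∷ xs) ∎

-- No element of `zs` can be matched inside `zs` or into `xs`, so `zs` is matched bijectively with
-- `ys`, which it exhausts.
Pf-++ : ∀ (A : X → X → Bool) zs ys xs → length zs ≡ length ys →
  (∀ {z z′} → z ∈ zs → z′ ∈ zs → A z z′ ≡ false) →
  (∀ {z x} → z ∈ zs → x ∈ xs → A z x ≡ false) →
  Pf A (zs ++ ys ++ xs) ≡ Det A zs ys ∧ Pf A xs
Pf-++ A []       []  xs len zz zx = refl
Pf-++ A (z ∷ zs) ys xs len zz zx = begin
  Pf A (z ∷ zs ++ ys ++ xs)
    ≡⟨ Pf-∷ A z (zs ++ ys ++ xs) ⟩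
  sumPicks (zs ++ ys ++ xs) (λ w ws → A z w ∧ Pf A ws)
    ≡⟨ sumPicks-++ zs (ys ++ xs) _ ⟩
  sumPicks zs (λ w ws → A z w ∧ Pf A (ws ++ ys ++ xs)) xor
    sumPicks (ys ++ xs) (λ w ws → A z w ∧ Pf A (zs ++ ws))
    ≡⟨ cong₂ _xor_
         (sumPicks-false zs (λ w ws p → cong (_∧ Pf A (ws ++ ys ++ xs))
           (zz (here refl) (there (∈-resp-↭ p (here refl))))))
         (sumPicks-++ ys xs _) ⟩
  sumPicks ys (λ w ws → A z w ∧ Pf A (zs ++ ws ++ xs)) xor
    sumPicks xs (λ w ws → A z w ∧ Pf A (zs ++ ys ++ ws))
    ≡⟨ cong₂ _xor_
         (sumPicks-cong ys (λ w ws p → ≡-trans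
           (cong (A z w ∧_) (Pf-++ A zs ws xs (suc-injective (≡-trans len (sym (↭-length p))))
             (λ a b → zz (there a) (there b)) (λ a b → zx (there a) b)))
           (sym (∧-assoc (A z w) _ _))))
         (sumPicks-false xs (λ w ws p → cong (_∧ Pf A (zs ++ ys ++ ws))
           (zx (here refl) (∈-resp-↭ p (here refl))))) ⟩
  sumPicks ys (λ w ws → (A z w ∧ Det A zs ws) ∧ Pf A xs) xor false
    ≡⟨ xor-identityʳ _ ⟩
  sumPicks ys (λ w ws → (A z w ∧ Det A zs ws) ∧ Pf A xs)
    ≡⟨ sumPicks-∧ʳ ys _ (Pf A xs) ⟩
  Det A (z ∷ zs) ys ∧ Pf A xs ∎

-- Counting matchings modulo 2

sum-cong : ∀ (xs : List X) {f g} → (∀ {x} → x ∈ xs → f x ≡ g x) → sum xs f ≡ sum xs g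
sum-cong []       eq = refl
sum-cong (x ∷ xs) eq = cong₂ _xor_ (eq (here refl)) (sum-cong xs (eq ∘ there))

sum-false : ∀ (xs : List X) {f} → (∀ {x} → x ∈ xs → f x ≡ false) → sum xs f ≡ false
sum-false []       eq = refl
sum-false (x ∷ xs) eq = cong₂ _xor_ (eq (here refl)) (sum-false xs (eq ∘ there))

sum-xor : ∀ (xs : List X) (f g : X → Bool) → sum xs (λ x → f x xor g x) ≡ sum xs f xor sum xs g
sum-xor []       f g = refl
sum-xor (x ∷ xs) f g =
  ≡-trans (cong ((f x xor g x) xor_) (sum-xor xs f g)) (xor-interchange (f x) (g x) _ _)

sum-∧ˡ : ∀ (xs : List X) b (f : X → Bool) → sum xs (λ x → b ∧ f x) ≡ b ∧ sum xs f
sum-∧ˡ xs true  f = refl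
sum-∧ˡ xs false f = sum-false xs (λ _ → refl)

sum-++ : ∀ (xs ys : List X) f → sum (xs ++ ys) f ≡ sum xs f xor sum ys f
sum-++ []       ys f = refl
sum-++ (x ∷ xs) ys f = ≡-trans (cong (f x xor_) (sum-++ xs ys f)) (sym (xor-assoc (f x) _ _))

sum-map : ∀ (p : X → Y) xs f → sum (map p xs) f ≡ sum xs (f ∘ p)
sum-map p []       f = refl
sum-map p (x ∷ xs) f = cong (f (p x) xor_) (sum-map p xs f)

sum-cartesianProduct : ∀ (xs : List X) (ys : List Y) f →
  sum (cartesianProduct xs ys) f ≡ sum xs (λ x → sum ys (λ y → f (x , y)))
sum-cartesianProduct []       ys f = refl
sum-cartesianProduct (x ∷ xs) ys f = ≡-trans (sum-++ (map (x ,_) ys) _ f)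
  (cong₂ _xor_ (sum-map (x ,_) ys f) (sum-cartesianProduct xs ys f))

sum-filter : ∀ (p : X → Bool) xs f → sum (filter (λ x → T? (p x)) xs) f ≡ sum xs (λ x → p x ∧ f x)
sum-filter p []       f = refl
sum-filter p (x ∷ xs) f with p x
... | true  = cong (f x xor_) (sum-filter p xs f)
... | false = sum-filter p xs f

sum-sumPicks : ∀ (xs : List X) (ys : List Y) (f : X → Y → List Y → Bool) →
  sum xs (λ x → sumPicks ys (f x)) ≡ sumPicks ys (λ z zs → sum xs (λ x → f x z zs))
sum-sumPicks xs []       f = sum-false xs (λ _ → refl)
sum-sumPicks xs (y ∷ ys) f = ≡-trans (sum-xor xs (λ x → f x y ys) _)
  (cong (sum xs (λ x → f x y ys) xor_) (sum-sumPicks xs ys _))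

false≢true : false ≢ true
false≢true ()

odd : ℕ → Bool
odd zero    = false
odd (suc n) = not (odd n)

odd-length-filter : ∀ (p : X → Bool) xs → odd (length (filter (λ x → T? (p x)) xs)) ≡ sum xs p
odd-length-filter p []       = refl
odd-length-filter p (x ∷ xs) with p x
... | true  = cong not (odd-length-filter p xs)
... | false = odd-length-filter p xs

≡ᵇ-refl : ∀ n → (n ≡ᵇ n) ≡ true
≡ᵇ-refl zero    = refl
≡ᵇ-refl (suc n) = ≡ᵇ-refl n

≡ᵇ-sym : ∀ m n → (m ≡ᵇ n) ≡ (n ≡ᵇ m)
≡ᵇ-sym zero    zero    = refl
≡ᵇ-sym zero    (suc n) = refl
≡ᵇ-sym (suc m) zero    = refl
≡ᵇ-sym (suc m) (suc n) = ≡ᵇ-sym m n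

≡ᵇ-sound : ∀ m n → (m ≡ᵇ n) ≡ true → m ≡ n
≡ᵇ-sound m n eq = ≡ᵇ⇒≡ m n (Equivalence.from T-≡ eq)

≢⇒≡ᵇ-false : ∀ m n → m ≢ n → (m ≡ᵇ n) ≡ false
≢⇒≡ᵇ-false m n m≢n = ¬-not (m≢n ∘ ≡ᵇ-sound m n)

eqV-refl : ∀ v → eqV v v ≡ true
eqV-refl (i , j) = cong₂ _∧_ (≡ᵇ-refl i) (≡ᵇ-refl j)

eqV-sound : ∀ v w → eqV v w ≡ true → v ≡ w
eqV-sound (i , j) (i′ , j′) eq with i ≡ᵇ i′ in eq₁ | j ≡ᵇ j′ in eq₂
... | true | true = cong₂ _,_ (≡ᵇ-sound i i′ eq₁) (≡ᵇ-sound j j′ eq₂)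

≢⇒eqV-false : ∀ {v w} → v ≢ w → eqV v w ≡ false
≢⇒eqV-false {v} {w} v≢w = ¬-not (v≢w ∘ eqV-sound v w)

sum-eqV : ∀ {vs v} (f : Vertex → Bool) → Unique vs → v ∈ vs → sum vs (λ w → eqV w v ∧ f w) ≡ f v
sum-eqV {v ∷ vs} f (v∉vs ∷ _) (here refl) = ≡-trans
  (cong₂ _xor_ (cong (_∧ f v) (eqV-refl v))
    (sum-false vs (λ {w} w∈vs → cong (_∧ f w) (≢⇒eqV-false (All.lookup v∉vs w∈vs ∘ sym)))))
  (xor-identityʳ (f v))
sum-eqV {w ∷ vs} f (w∉vs ∷ u) (there v∈vs) =
  cong₂ _xor_ (cong (_∧ f w) (≢⇒eqV-false (All.lookup w∉vs v∈vs))) (sum-eqV f u v∈vs)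

all-false : ∀ {x} {xs : List X} (p : X → Bool) → x ∈ xs → p x ≡ false → all p xs ≡ false
all-false {xs = y ∷ xs} p (here refl)  eq = cong (_∧ all p xs) eq
all-false {xs = y ∷ xs} p (there x∈xs) eq =
  ≡-trans (cong (p y ∧_) (all-false p x∈xs eq)) (∧-zeroʳ (p y))

all-cong : ∀ (xs : List X) {p q} → (∀ {x} → x ∈ xs → p x ≡ q x) → all p xs ≡ all q xs
all-cong []       eq = refl
all-cong (x ∷ xs) eq = cong₂ _∧_ (eq (here refl)) (all-cong xs (eq ∘ there))

all-↭ : ∀ {xs ys : List X} (p : X → Bool) → xs ↭ ys → all p xs ≡ all p ys
all-↭ p refl = refl
all-↭ p (prep x r) = cong (p x ∧_) (all-↭ p r)
all-↭ p (swap x y r) = ≡-trans (∧-swap (p x) (p y) _) (cong (λ b → p y ∧ (p x ∧ b)) (all-↭ p r))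
all-↭ p (trans r s) = ≡-trans (all-↭ p r) (all-↭ p s)

no-zero : ∀ (d : X → ℕ) xs →
  and (map (λ v → d v ≤ᵇ 1) xs) ∧ (length (filter (λ v → T? (d v ≡ᵇ 0)) xs) ≡ᵇ 0) ≡
  all (λ v → d v ≡ᵇ 1) xs
no-zero d []       = refl
no-zero d (x ∷ xs) with d x
... | zero        = ∧-zeroʳ _
... | suc zero    = no-zero d xs
... | suc (suc _) = refl

-- The sum runs over the candidates for the uncovered vertex. At most one of its terms is true, so
-- nothing is lost by summing modulo 2.
one-zero : ∀ (d : X → ℕ) xs →
  and (map (λ v → d v ≤ᵇ 1) xs) ∧ (length (filter (λ v → T? (d v ≡ᵇ 0)) xs) ≡ᵇ 1) ≡
  sumPicks xs (λ y ys → (d y ≡ᵇ 0) ∧ all (λ v → d v ≡ᵇ 1) ys)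
one-zero d []       = refl
one-zero d (x ∷ xs) with d x
... | zero        = ≡-trans (no-zero d xs) (≡-trans (sym (xor-identityʳ _))
  (cong (all (λ v → d v ≡ᵇ 1) xs xor_) (sym (sumPicks-false xs (λ y ys _ → ∧-zeroʳ (d y ≡ᵇ 0))))))
... | suc zero    = one-zero d xs
... | suc (suc _) = sym (sumPicks-false xs (λ y ys _ → ∧-zeroʳ (d y ≡ᵇ 0)))

-- With the exclusive or, `joins v v` is false for every edge. Hence `linked E` is an alternating
-- matrix whose entry at distinct `v` and `w` is the number of edges between them modulo 2.
joins : Vertex → Vertex → Edge → Bool
joins v w (a , b) = (eqV a v ∧ eqV b w) xor (eqV a w ∧ eqV b v)

linked : List Edge → Vertex → Vertex → Bool
linked E v w = sum E (joins v w)

linked-sym : ∀ E v w → linked E v w ≡ linked E w v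
linked-sym E v w = sum-cong E (λ { {a , b} _ → xor-comm (eqV a v ∧ eqV b w) _ })

joins-false : ∀ {v w a} b → a ≢ v → a ≢ w → joins v w (a , b) ≡ false
joins-false {v} {w} {a} b a≢v a≢w =
  cong₂ _xor_ (cong (_∧ eqV b w) (≢⇒eqV-false a≢v)) (cong (_∧ eqV b v) (≢⇒eqV-false a≢w))

joins-falseʳ : ∀ {v w} a {b} → b ≢ v → b ≢ w → joins v w (a , b) ≡ false
joins-falseʳ {v} {w} a {b} b≢v b≢w = cong₂ _xor_
  (≡-trans (cong (eqV a v ∧_) (≢⇒eqV-false b≢w)) (∧-zeroʳ _))
  (≡-trans (cong (eqV a w ∧_) (≢⇒eqV-false b≢v)) (∧-zeroʳ _))

linked-∷ : ∀ e E {v w} → joins v w e ≡ false → linked (e ∷ E) v w ≡ linked E v w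
linked-∷ e E {v} {w} eq = cong (_xor linked E v w) eq

-- The new edge changes only the entry of the pair `a`, `b`. The additional terms are the matchings
-- that contain it, that is, the matchings of `W`.
Pf-linked-∷ : ∀ {a b} E {W} → a ≢ b → Unique (a ∷ b ∷ W) →
  Pf (linked ((a , b) ∷ E)) (a ∷ b ∷ W) ≡ Pf (linked E) (a ∷ b ∷ W) xor Pf (linked E) W
Pf-linked-∷ {a} {b} E {W} a≢b ((_ ∷ a∉W) ∷ (b∉W ∷ _)) = begin
  Pf (linked (e ∷ E)) (a ∷ b ∷ W)
    ≡⟨ Pf-∷ (linked (e ∷ E)) a (b ∷ W) ⟩
  (linked (e ∷ E) a b ∧ Pf (linked (e ∷ E)) W) xor
    sumPicks W (λ w ws → linked (e ∷ E) a w ∧ Pf (linked (e ∷ E)) (b ∷ ws))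
    ≡⟨ cong₂ _xor_
         (cong₂ (λ x y → (x xor linked E a b) ∧ y) joins-ab
           (Pf-cong W (λ v∈W w∈W → linked-∷ e E (joins-false b (All.lookup a∉W v∈W) (All.lookup a∉W w∈W)))))
         (sumPicks-cong W (λ w ws p → cong₂ _∧_
           (linked-∷ e E (≡-trans (cong₂ _xor_
             (≡-trans (cong (eqV a a ∧_) (≢⇒eqV-false (All.lookup b∉W (∈-resp-↭ p (here refl)))))
                      (∧-zeroʳ _))
             (cong (_∧ eqV b a) (≢⇒eqV-false (All.lookup a∉W (∈-resp-↭ p (here refl)))))) refl))
           (Pf-cong (b ∷ ws) (λ v∈ w∈ → linked-∷ e E (joins-false b (a≢ p v∈) (a≢ p w∈)))))) ⟩
  ((true xor linked E a b) ∧ Pf (linked E) W) xor rest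
    ≡⟨ lemma (linked E a b) (Pf (linked E) W) rest ⟩
  ((linked E a b ∧ Pf (linked E) W) xor rest) xor Pf (linked E) W
    ≡⟨ cong (_xor Pf (linked E) W) (Pf-∷ (linked E) a (b ∷ W)) ⟨
  Pf (linked E) (a ∷ b ∷ W) xor Pf (linked E) W ∎
  where
  e = a , b
  rest = sumPicks W (λ w ws → linked E a w ∧ Pf (linked E) (b ∷ ws))
  joins-ab : joins a b e ≡ true
  joins-ab = cong₂ _xor_ (cong₂ _∧_ (eqV-refl a) (eqV-refl b)) (cong (_∧ eqV b a) (≢⇒eqV-false a≢b))
  a≢ : ∀ {w ws v} → w ∷ ws ↭ W → v ∈ b ∷ ws → a ≢ v
  a≢ p (here refl) = a≢b
  a≢ p (there v∈)  = All.lookup a∉W (∈-resp-↭ p (there v∈))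
  lemma : ∀ l x r → ((true xor l) ∧ x) xor r ≡ ((l ∧ x) xor r) xor x
  lemma true  true  true  = refl
  lemma true  true  false = refl
  lemma true  false true  = refl
  lemma true  false false = refl
  lemma false true  true  = refl
  lemma false true  false = refl
  lemma false false true  = refl
  lemma false false false = refl

incident-left : ∀ a b → incident a (a , b) ≡ true
incident-left a b = cong (_∨ eqV a b) (eqV-refl a)

incident-right : ∀ a b → incident b (a , b) ≡ true
incident-right a b = ≡-trans (cong (eqV b a ∨_) (eqV-refl b)) (∨-zeroʳ (eqV b a))

degree-incident : ∀ v e M → incident v e ≡ true → degree (e ∷ M) v ≡ suc (degree M v)
degree-incident v e M eq with incident v e | eq
... | true | _ = refl

degree-disjoint : ∀ v a b M → a ≢ v → b ≢ v → degree ((a , b) ∷ M) v ≡ degree M v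
degree-disjoint v a b M a≢v b≢v
  with incident v (a , b) | cong₂ _∨_ (≢⇒eqV-false (a≢v ∘ sym)) (≢⇒eqV-false (b≢v ∘ sym))
... | false | _ = refl

hasDegrees : List Vertex → List Vertex → List Edge → Bool
hasDegrees Z W M = all (λ v → degree M v ≡ᵇ 0) Z ∧ all (λ v → degree M v ≡ᵇ 1) W

Unique-resp-↭ : ∀ {xs ys : List X} → xs ↭ ys → Unique xs → Unique ys
Unique-resp-↭ {X} p = SetoidPermutation.Unique-resp-↭ (setoid X) (↭⇒↭ₛ p)

-- The vertices of Z are to be left uncovered.
sum-hasDegrees : ∀ E Z W → Unique (Z ++ W) →
  (∀ {a b} → (a , b) ∈ E → a ≢ b × a ∈ Z ++ W × b ∈ Z ++ W) →
  sum (subsets E) (hasDegrees Z W) ≡ Pf (linked E) W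
sum-hasDegrees [] Z W u ends = ≡-trans (xor-identityʳ _)
  (≡-trans (cong (_∧ all (λ v → 0 ≡ᵇ 1) W) (all-true Z)) (base W))
  where
  all-true : ∀ (Z : List Vertex) → all (λ v → true) Z ≡ true
  all-true []      = refl
  all-true (_ ∷ Z) = all-true Z
  base : ∀ (W : List Vertex) → all (λ v → false) W ≡ Pf (linked []) W
  base []      = refl
  base (w ∷ W) = sym (≡-trans (Pf-∷ (linked []) w W) (sumPicks-false W (λ _ _ _ → refl)))
sum-hasDegrees ((a , b) ∷ E) Z W u ends = begin
  sum (subsets E ++ map (e ∷_) (subsets E)) (hasDegrees Z W)
    ≡⟨ sum-++ (subsets E) _ _ ⟩
  sum (subsets E) (hasDegrees Z W) xor sum (map (e ∷_) (subsets E)) (hasDegrees Z W)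
    ≡⟨ cong₂ _xor_ (sum-hasDegrees E Z W u (ends ∘ there)) (sum-map (e ∷_) (subsets E) _) ⟩
  Pf (linked E) W xor sum (subsets E) (λ M → hasDegrees Z W (e ∷ M))
    ≡⟨ step (∈-++⁻ Z (proj₁ (proj₂ (ends (here refl))))) (∈-++⁻ Z (proj₂ (proj₂ (ends (here refl))))) ⟩
  Pf (linked (e ∷ E)) W ∎
  where
  e = a , b
  a≢b = proj₁ (ends (here refl))
  disjoint : ∀ {Z : List Vertex} {x y} → Unique (Z ++ W) → x ∈ Z → y ∈ W → x ≢ y
  disjoint {_ ∷ Z} (x∉ ∷ _) (here refl) y∈ = All.lookup x∉ (∈-++⁺ʳ Z y∈)
  disjoint {_ ∷ Z} (_ ∷ u)  (there x∈)  y∈ = disjoint u x∈ y∈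

  covered-zero : ∀ v → v ∈ Z → incident v e ≡ true →
    sum (subsets E) (λ M → hasDegrees Z W (e ∷ M)) ≡ false
  covered-zero v v∈Z inc = sum-false (subsets E) (λ {M} _ →
    cong (_∧ all (λ v → degree (e ∷ M) v ≡ᵇ 1) W)
      (all-false (λ v → degree (e ∷ M) v ≡ᵇ 0) v∈Z (cong (_≡ᵇ 0) (degree-incident v e M inc))))

  same : (∀ {v w} → v ∈ W → w ∈ W → joins v w e ≡ false) → Pf (linked (e ∷ E)) W ≡ Pf (linked E) W
  same eq = Pf-cong W (λ v∈ w∈ → linked-∷ e E (eq v∈ w∈))

  step : _ → _ → Pf (linked E) W xor sum (subsets E) (λ M → hasDegrees Z W (e ∷ M)) ≡
    Pf (linked (e ∷ E)) W
  -- An edge with an endpoint in `Z` lies in no admissible subset, and the form restricted to `W`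
  -- does not see it.
  step (inj₁ a∈Z) _ = ≡-trans (cong (Pf (linked E) W xor_) (covered-zero a a∈Z (incident-left a b)))
    (≡-trans (xor-identityʳ _) (sym (same (λ v∈ w∈ →
      joins-false b (disjoint u a∈Z v∈) (disjoint u a∈Z w∈)))))
  step (inj₂ _) (inj₁ b∈Z) = ≡-trans (cong (Pf (linked E) W xor_) (covered-zero b b∈Z (incident-right a b)))
    (≡-trans (xor-identityʳ _) (sym (same (λ v∈ w∈ →
      joins-falseʳ a (disjoint u b∈Z v∈) (disjoint u b∈Z w∈)))))
  -- In a subset containing `e` the other edges must avoid both endpoints, so these move from `W` to
  -- `Z`.
  step (inj₂ a∈W) (inj₂ b∈W) with ∈⇒↭∷ a∈W
  ... | W₁ , p₁ with ∈-resp-↭ p₁ b∈W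
  ...   | here b≡a = ⊥-elim (a≢b (sym b≡a))
  ...   | there b∈W₁ with ∈⇒↭∷ b∈W₁
  ...     | W₂ , p₂ = begin
    Pf (linked E) W xor sum (subsets E) (λ M → hasDegrees Z W (e ∷ M))
      ≡⟨ cong₂ _xor_ (Pfaffian.Pf-↭ (linked E) (linked-sym E) p)
           (sum-cong (subsets E) (λ {M} _ → degrees M)) ⟩
    Pf (linked E) (a ∷ b ∷ W₂) xor sum (subsets E) (hasDegrees (a ∷ b ∷ Z) W₂)
      ≡⟨ cong (Pf (linked E) (a ∷ b ∷ W₂) xor_)
           (sum-hasDegrees E (a ∷ b ∷ Z) W₂ u′ ends′) ⟩
    Pf (linked E) (a ∷ b ∷ W₂) xor Pf (linked E) W₂
      ≡⟨ Pf-linked-∷ E a≢b uW ⟨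
    Pf (linked (e ∷ E)) (a ∷ b ∷ W₂)
      ≡⟨ Pfaffian.Pf-↭ (linked (e ∷ E)) (linked-sym (e ∷ E)) p ⟨
    Pf (linked (e ∷ E)) W ∎
    where
    p : W ↭ a ∷ b ∷ W₂
    p = trans p₁ (prep a p₂)
    q : Z ++ W ↭ a ∷ b ∷ Z ++ W₂
    q = trans (++⁺ˡ Z p) (trans (shift a Z (b ∷ W₂)) (prep a (shift b Z W₂)))
    u′ : Unique (a ∷ b ∷ Z ++ W₂)
    u′ = Unique-resp-↭ q u
    drop-prefix : ∀ (Z : List Vertex) {W} → Unique (Z ++ W) → Unique W
    drop-prefix []      u       = u
    drop-prefix (_ ∷ Z) (_ ∷ u) = drop-prefix Z u
    uW : Unique (a ∷ b ∷ W₂)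
    uW = Unique-resp-↭ p (drop-prefix Z u)
    ends′ : ∀ {x y} → (x , y) ∈ E → x ≢ y × x ∈ a ∷ b ∷ Z ++ W₂ × y ∈ a ∷ b ∷ Z ++ W₂
    ends′ i with ends (there i)
    ... | x≢y , x∈ , y∈ = x≢y , ∈-resp-↭ q x∈ , ∈-resp-↭ q y∈
    untouched : ∀ M {v} → v ∈ Z ++ W₂ → degree (e ∷ M) v ≡ degree M v
    untouched M {v} v∈ with u′
    ... | (_ ∷ a∉) ∷ b∉ ∷ _ = degree-disjoint v a b M (All.lookup a∉ v∈) (All.lookup b∉ v∈)
    rearrange : ∀ z x y w → z ∧ (x ∧ (y ∧ w)) ≡ (x ∧ (y ∧ z)) ∧ w
    rearrange z x y w = ≡-trans (∧-swap z x _) (≡-trans (cong (x ∧_)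
      (≡-trans (∧-swap z y w) (sym (∧-assoc y z w)))) (sym (∧-assoc x _ w)))
    degrees : ∀ M → hasDegrees Z W (e ∷ M) ≡ hasDegrees (a ∷ b ∷ Z) W₂ M
    degrees M = begin
      hasDegrees Z W (e ∷ M)
        ≡⟨ cong (all (λ v → degree (e ∷ M) v ≡ᵇ 0) Z ∧_) (all-↭ _ p) ⟩
      hasDegrees Z (a ∷ b ∷ W₂) (e ∷ M)
        ≡⟨ cong₂ _∧_
             (all-cong Z (λ v∈ → cong (_≡ᵇ 0) (untouched M (∈-++⁺ˡ v∈))))
             (cong₂ _∧_ (cong (_≡ᵇ 1) (degree-incident a e M (incident-left a b)))
               (cong₂ _∧_ (cong (_≡ᵇ 1) (degree-incident b e M (incident-right a b)))
                 (all-cong W₂ (λ v∈ → cong (_≡ᵇ 1) (untouched M (∈-++⁺ʳ Z v∈)))))) ⟩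
      all (λ v → degree M v ≡ᵇ 0) Z ∧
        ((degree M a ≡ᵇ 0) ∧ ((degree M b ≡ᵇ 0) ∧ all (λ v → degree M v ≡ᵇ 1) W₂))
        ≡⟨ rearrange (all (λ v → degree M v ≡ᵇ 0) Z) (degree M a ≡ᵇ 0) (degree M b ≡ᵇ 0) _ ⟩
      hasDegrees (a ∷ b ∷ Z) W₂ M ∎

-- Here and in `adj` the alternatives exclude each other; exclusive or in place of disjunction lets
-- sums over neighbours split linearly.
adj₁ : ℕ → ℕ → Bool
adj₁ i j = (suc i ≡ᵇ j) xor (suc j ≡ᵇ i)

adj : Vertex → Vertex → Bool
adj (i , j) (i′ , j′) = ((i ≡ᵇ i′) ∧ adj₁ j j′) xor ((j ≡ᵇ j′) ∧ adj₁ i i′)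

adj-oriented : ∀ v w → adjOriented v w xor adjOriented w v ≡ adj v w
adj-oriented (i , j) (i′ , j′) rewrite ≡ᵇ-sym i′ i | ≡ᵇ-sym j′ j with i ≡ᵇ i′ in eq
... | false = sym (∧-distribˡ-xor (j ≡ᵇ j′) _ _)
... | true with refl ← ≡ᵇ-sound i i′ eq rewrite ≢⇒≡ᵇ-false (suc i) i 1+n≢n
  | ∧-zeroʳ (j ≡ᵇ j′) =
  ≡-trans (cong₂ _xor_ (∨-identityʳ (suc j ≡ᵇ j′)) (∨-identityʳ (suc j′ ≡ᵇ j))) (sym (xor-identityʳ _))

adjOriented-irrefl : ∀ v → adjOriented v v ≡ false
adjOriented-irrefl (i , j) rewrite ≢⇒≡ᵇ-false (suc i) i 1+n≢n | ≢⇒≡ᵇ-false (suc j) j 1+n≢n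
  | ∧-zeroʳ (j ≡ᵇ j) | ∧-zeroʳ (i ≡ᵇ i) = refl

vertices-unique : ∀ r c → Unique (vertices r c)
vertices-unique r c = cartesianProduct⁺ (upTo⁺ r) (upTo⁺ c)

edges-endpoints : ∀ r c {a b} → (a , b) ∈ edges r c → a ≢ b × a ∈ vertices r c × b ∈ vertices r c
edges-endpoints r c {a} {b} i with ∈-filter⁻ (λ e → T? (adjOriented (proj₁ e) (proj₂ e))) i
... | ab∈ , adjacent = a≢b , ∈-cartesianProduct⁻ (vertices r c) (vertices r c) ab∈
  where
  a≢b : a ≢ b
  a≢b refl = subst T (adjOriented-irrefl a) adjacent

-- Each edge is listed in one orientation only. Summing over both endpoints against the indicators
-- of `v` and `w` leaves the two orientations of this single pair.
linked-edges : ∀ r c {v w} → v ∈ vertices r c → w ∈ vertices r c → linked (edges r c) v w ≡ adj v w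
linked-edges r c {v} {w} v∈ w∈ = begin
  linked (edges r c) v w
    ≡⟨ sum-filter (λ e → adjOriented (proj₁ e) (proj₂ e)) (cartesianProduct V V) (joins v w) ⟩
  sum (cartesianProduct V V) (λ e → adjOriented (proj₁ e) (proj₂ e) ∧ joins v w e)
    ≡⟨ sum-cartesianProduct V V _ ⟩
  sum V (λ a → sum V (λ b → adjOriented a b ∧ joins v w (a , b)))
    ≡⟨ sum-cong V (λ {a} _ → ≡-trans (sum-cong V (λ {b} _ →
         ≡-trans (∧-distribˡ-xor (adjOriented a b) _ _)
           (cong₂ _xor_ (rearrange (adjOriented a b) (eqV a v) (eqV b w))
                        (rearrange (adjOriented a b) (eqV a w) (eqV b v)))))
         (≡-trans (sum-xor V _ _) (cong₂ _xor_ (inner a v w w∈) (inner a w v v∈)))) ⟩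
  sum V (λ a → (eqV a v ∧ adjOriented a w) xor (eqV a w ∧ adjOriented a v))
    ≡⟨ sum-xor V _ _ ⟩
  sum V (λ a → eqV a v ∧ adjOriented a w) xor sum V (λ a → eqV a w ∧ adjOriented a v)
    ≡⟨ cong₂ _xor_ (sum-eqV (λ a → adjOriented a w) u v∈) (sum-eqV (λ a → adjOriented a v) u w∈) ⟩
  adjOriented v w xor adjOriented w v
    ≡⟨ adj-oriented v w ⟩
  adj v w ∎
  where
  V = vertices r c
  u = vertices-unique r c
  rearrange : ∀ x y z → x ∧ (y ∧ z) ≡ y ∧ (z ∧ x)
  rearrange x y z = ≡-trans (∧-swap x y z) (cong (y ∧_) (∧-comm x z))
  inner : ∀ a v w → w ∈ V → sum V (λ b → eqV a v ∧ (eqV b w ∧ adjOriented a b)) ≡ eqV a v ∧ adjOriented a w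
  inner a v w w∈ = ≡-trans (sum-∧ˡ V (eqV a v) _) (cong (eqV a v ∧_) (sum-eqV (adjOriented a) u w∈))

cone : (X → X → Bool) → Maybe X → Maybe X → Bool
cone A nothing  nothing  = false
cone A nothing  (just _) = true
cone A (just _) nothing  = true
cone A (just x) (just y) = A x y

-- In the expansion along the apex, the partner of the apex is the uncovered vertex.
nearPerfectCount-Pf : ∀ r c →
  odd (nearPerfectCount r c) ≡ Pf (cone adj) (nothing ∷ map just (vertices r c))
nearPerfectCount-Pf r c = begin
  odd (nearPerfectCount r c)
    ≡⟨ odd-length-filter (isNearPerfect r c) (subsets E) ⟩
  sum (subsets E) (isNearPerfect r c)
    ≡⟨ sum-cong (subsets E) (λ {M} _ → one-zero (degree M) V) ⟩
  sum (subsets E) (λ M → sumPicks V (λ v vs → (degree M v ≡ᵇ 0) ∧ all (λ w → degree M w ≡ᵇ 1) vs))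
    ≡⟨ sum-sumPicks (subsets E) V _ ⟩
  sumPicks V (λ v vs → sum (subsets E) (λ M → (degree M v ≡ᵇ 0) ∧ all (λ w → degree M w ≡ᵇ 1) vs))
    ≡⟨ sumPicks-cong V missing ⟩
  sumPicks V (λ v vs → Pf adj vs)
    ≡⟨ sumPicks-cong V (λ v vs _ → Pf-map (cone adj) just vs) ⟨
  sumPicks V (λ v vs → Pf (cone adj) (map just vs))
    ≡⟨ sumPicks-map just V _ ⟨
  sumPicks (map just V) (λ y ys → true ∧ Pf (cone adj) ys)
    ≡⟨ sumPicks-just V ⟩
  sumPicks (map just V) (λ y ys → cone adj nothing y ∧ Pf (cone adj) ys)
    ≡⟨ Pf-∷ (cone adj) nothing (map just V) ⟨
  Pf (cone adj) (nothing ∷ map just V) ∎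
  where
  V = vertices r c
  E = edges r c
  sumPicks-just : ∀ V → sumPicks (map just V) (λ y ys → true ∧ Pf (cone adj) ys) ≡
    sumPicks (map just V) (λ y ys → cone adj nothing y ∧ Pf (cone adj) ys)
  sumPicks-just V = ≡-trans (sumPicks-map just V _) (sym (sumPicks-map just V _))
  missing : ∀ v vs → v ∷ vs ↭ V →
    sum (subsets E) (λ M → (degree M v ≡ᵇ 0) ∧ all (λ w → degree M w ≡ᵇ 1) vs) ≡ Pf adj vs
  missing v vs p = begin
    sum (subsets E) (λ M → (degree M v ≡ᵇ 0) ∧ all (λ w → degree M w ≡ᵇ 1) vs)
      ≡⟨ sum-cong (subsets E) (λ {M} _ →
           cong (_∧ all (λ w → degree M w ≡ᵇ 1) vs) (sym (∧-identityʳ (degree M v ≡ᵇ 0)))) ⟩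
    sum (subsets E) (hasDegrees (v ∷ []) vs)
      ≡⟨ sum-hasDegrees E (v ∷ []) vs (Unique-resp-↭ (↭-sym p) (vertices-unique r c)) ends ⟩
    Pf (linked E) vs
      ≡⟨ Pf-cong vs (λ v∈ w∈ → linked-edges r c (∈-resp-↭ p (there v∈)) (∈-resp-↭ p (there w∈))) ⟩
    Pf adj vs ∎
    where
    ends : ∀ {a b} → (a , b) ∈ E → a ≢ b × a ∈ v ∷ vs × b ∈ v ∷ vs
    ends i with edges-endpoints r c i
    ... | a≢b , a∈ , b∈ = a≢b , ∈-resp-↭ (↭-sym p) a∈ , ∈-resp-↭ (↭-sym p) b∈

-- Reflecting the grid

-- Replacing each x on one side of a reflection σ by the formal sum x + σ x, encoded as (true , x),
-- cancels everything except the edges to the other side.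
module Reflection (A : X → X → Bool) (A-sym : ∀ x y → A x y ≡ A y x) (A-loopless : ∀ x → A x x ≡ false)
  (σ : X → X) where

  private
    -- The bilinear extension of `A` to plain elements and formal sums; the flags switch the mirror
    -- images on.
    B : Bool × X → Bool × X → Bool
    B (b , x) (c , y) = (A x y xor (c ∧ A x (σ y))) xor (b ∧ (A (σ x) y xor (c ∧ A (σ x) (σ y))))

    B-sym : ∀ x y → B x y ≡ B y x
    B-sym (true  , x) (true  , y) = ≡-trans (xor-interchange (A x y) _ _ _)
      (cong₂ _xor_ (cong₂ _xor_ (A-sym _ _) (A-sym _ _)) (cong₂ _xor_ (A-sym _ _) (A-sym _ _)))
    B-sym (true  , x) (false , y) = ≡-trans
      (cong₂ _xor_ (≡-trans (xor-identityʳ _) (A-sym x y)) (≡-trans (xor-identityʳ _) (A-sym (σ x) y)))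
      (sym (xor-identityʳ _))
    B-sym (false , x) (true  , y) = ≡-trans (xor-identityʳ _) (cong₂ _xor_
      (≡-trans (A-sym x y) (sym (xor-identityʳ _))) (≡-trans (A-sym x (σ y)) (sym (xor-identityʳ _))))
    B-sym (false , x) (false , y) = cong (λ b → (b xor false) xor false) (A-sym x y)

    B-loopless : ∀ x → B x x ≡ false
    B-loopless (true  , x) = begin
      (A x x xor A x (σ x)) xor (A (σ x) x xor A (σ x) (σ x))
        ≡⟨ cong₂ (λ a b → (a xor A x (σ x)) xor (A (σ x) x xor b)) (A-loopless x) (A-loopless (σ x)) ⟩
      A x (σ x) xor (A (σ x) x xor false)  ≡⟨ cong₂ _xor_ (A-sym x (σ x)) (xor-identityʳ _) ⟩
      A (σ x) x xor A (σ x) x              ≡⟨ xor-same (A (σ x) x) ⟩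
      false ∎
    B-loopless (false , x) = cong (λ b → (b xor false) xor false) (A-loopless x)

    B-add : ∀ x y → B (true , x) y ≡ B (false , x) y xor B (false , σ x) y
    B-add x (c , y) = cong₂ _xor_ (sym (xor-identityʳ (A x y xor (c ∧ A x (σ y)))))
      (sym (xor-identityʳ (A (σ x) y xor (c ∧ A (σ x) (σ y)))))

    open Pfaffian B B-sym
    open Alternating B-loopless

    -- Each replacement adds to `x` an element of the list: its plain mirror image, which stays in
    -- `ys` throughout.
    symmetrize : ∀ xs ys → (∀ {x} → x ∈ xs → (false , σ x) ∈ ys) →
      Pf B (map (false ,_) xs ++ ys) ≡ Pf B (map (true ,_) xs ++ ys)
    symmetrize []       ys mirrored = refl
    symmetrize (x ∷ xs) ys mirrored = begin
      Pf B ((false , x) ∷ map (false ,_) xs ++ ys)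
        ≡⟨ Pf-add {z = true , x} (∈-++⁺ʳ (map (false ,_) xs) (mirrored (here refl))) (B-add x) ⟩
      Pf B ((true , x) ∷ map (false ,_) xs ++ ys)
        ≡⟨ Pf-↭ (↭-sym (shift (true , x) (map (false ,_) xs) ys)) ⟩
      Pf B (map (false ,_) xs ++ (true , x) ∷ ys)
        ≡⟨ symmetrize xs ((true , x) ∷ ys) (there ∘ mirrored ∘ there) ⟩
      Pf B (map (true ,_) xs ++ (true , x) ∷ ys)
        ≡⟨ Pf-↭ (shift (true , x) (map (true ,_) xs) ys) ⟩
      Pf B ((true , x) ∷ map (true ,_) xs ++ ys) ∎

    Pf-plain : ∀ xs → Pf B (map (false ,_) xs) ≡ Pf A xs
    Pf-plain xs = ≡-trans (Pf-map B (false ,_) xs)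
      (Pf-cong xs (λ _ _ → ≡-trans (xor-identityʳ _) (xor-identityʳ _)))

  -- The first two conditions make any two sums orthogonal, the third makes them orthogonal to `ms`.
  -- A sum `x + σ x` pairs with `σ y` as `x` pairs with `y`, which turns the block of sums and
  -- mirror images into the matrix of `ls`.
  Pf-reflection : ∀ ls ms →
    (∀ {x y} → x ∈ ls → y ∈ ls → A (σ x) (σ y) ≡ A x y) →
    (∀ {x y} → x ∈ ls → y ∈ ls → A x (σ y) ≡ false) →
    (∀ {x y} → x ∈ ls → y ∈ ms → A (σ x) y ≡ A x y) →
    Pf A (ls ++ map σ ls ++ ms) ≡ Det A ls ls ∧ Pf A ms
  Pf-reflection ls ms iso far mid = begin
    Pf A (ls ++ map σ ls ++ ms)
      ≡⟨ Pf-plain (ls ++ map σ ls ++ ms) ⟨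
    Pf B (map plain (ls ++ map σ ls ++ ms))
      ≡⟨ cong (Pf B) (≡-trans (map-++ plain ls _)
           (cong (map plain ls ++_) (≡-trans (map-++ plain (map σ ls) ms)
             (cong (_++ map plain ms) (sym (map-∘ ls)))))) ⟩
    Pf B (map plain ls ++ map (plain ∘ σ) ls ++ map plain ms)
      ≡⟨ symmetrize ls _ (λ x∈ → ∈-++⁺ˡ (∈-map⁺ (plain ∘ σ) x∈)) ⟩
    Pf B (map (true ,_) ls ++ map (plain ∘ σ) ls ++ map plain ms)
      ≡⟨ Pf-++ B (map (true ,_) ls) (map (plain ∘ σ) ls) (map plain ms)
           (≡-trans (length-map _ ls) (sym (length-map _ ls))) sum-sum sum-mid ⟩
    Det B (map (true ,_) ls) (map (plain ∘ σ) ls) ∧ Pf B (map plain ms)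
      ≡⟨ cong₂ _∧_ (≡-trans (Det-map B (true ,_) (plain ∘ σ) ls ls) (Det-cong ls ls sum-right))
           (Pf-plain ms) ⟩
    Det A ls ls ∧ Pf A ms ∎
    where
    plain : X → Bool × X
    plain x = false , x

    sum-right : ∀ {x y} → x ∈ ls → y ∈ ls → B (true , x) (plain (σ y)) ≡ A x y
    sum-right {x} {y} x∈ y∈ = cong₂ _xor_ (≡-trans (xor-identityʳ _) (far x∈ y∈))
      (≡-trans (xor-identityʳ _) (iso x∈ y∈))

    sum-sum : ∀ {z z′} → z ∈ map (true ,_) ls → z′ ∈ map (true ,_) ls → B z z′ ≡ false
    sum-sum z∈ z′∈ with ∈-map⁻ (true ,_) z∈ | ∈-map⁻ (true ,_) z′∈
    ... | x , x∈ , refl | y , y∈ , refl = begin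
      (A x y xor A x (σ y)) xor (A (σ x) y xor A (σ x) (σ y))
        ≡⟨ cong₂ _xor_ (cong (A x y xor_) (far x∈ y∈))
             (cong₂ _xor_ (≡-trans (A-sym (σ x) y) (far y∈ x∈)) (iso x∈ y∈)) ⟩
      (A x y xor false) xor A x y   ≡⟨ cong (_xor A x y) (xor-identityʳ (A x y)) ⟩
      A x y xor A x y               ≡⟨ xor-same (A x y) ⟩
      false ∎

    sum-mid : ∀ {z w} → z ∈ map (true ,_) ls → w ∈ map plain ms → B z w ≡ false
    sum-mid z∈ w∈ with ∈-map⁻ (true ,_) z∈ | ∈-map⁻ plain w∈
    ... | x , x∈ , refl | y , y∈ , refl = begin
      (A x y xor false) xor (A (σ x) y xor false)
        ≡⟨ cong₂ _xor_ (xor-identityʳ (A x y)) (≡-trans (xor-identityʳ _) (mid x∈ y∈)) ⟩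
      A x y xor A x y
        ≡⟨ xor-same (A x y) ⟩
      false ∎

-- Intervals and grids as lists, and their mirror images.

interval : ℕ → ℕ → List ℕ
interval a zero    = []
interval a (suc n) = a ∷ interval (suc a) n

grid : ℕ → ℕ → ℕ → List Vertex
grid a n m = cartesianProduct (interval a n) (interval 0 m)

applyUpTo-interval : ∀ {f} a n → (∀ i → f i ≡ a + i) → applyUpTo f n ≡ interval a n
applyUpTo-interval a zero    eq = refl
applyUpTo-interval a (suc n) eq = cong₂ _∷_ (≡-trans (eq 0) (+-identityʳ a))
  (applyUpTo-interval (suc a) n (λ i → ≡-trans (eq (suc i)) (+-suc a i)))

vertices-grid : ∀ r c → vertices r c ≡ grid 0 r c
vertices-grid r c = cong₂ cartesianProduct
  (applyUpTo-interval 0 r (λ _ → refl)) (applyUpTo-interval 0 c (λ _ → refl))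

interval-++ : ∀ a m n → interval a (m + n) ≡ interval a m ++ interval (a + m) n
interval-++ a zero    n = cong (λ b → interval b n) (sym (+-identityʳ a))
interval-++ a (suc m) n = cong (a ∷_) (≡-trans (interval-++ (suc a) m n)
  (cong (λ b → interval (suc a) m ++ interval b n) (sym (+-suc a m))))

interval-last : ∀ a n → interval a (suc n) ↭ a + n ∷ interval a n
interval-last a zero    = ↭-reflexive (cong (_∷ []) (sym (+-identityʳ a)))
interval-last a (suc n) = trans (prep a (trans (interval-last (suc a) n)
  (↭-reflexive (cong (_∷ interval (suc a) n) (sym (+-suc a n)))))) (swap a (a + suc n) refl)

-- The equation says, without subtraction, that the first element `a` is sent to the last element of
-- the target interval.
interval-reverse : ∀ k a b n → b + n + a ≡ suc k → map (k ∸_) (interval a n) ↭ interval b n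
interval-reverse k a b zero    eq = refl
interval-reverse k a b (suc n) eq = trans
  (↭-reflexive (cong (_∷ map (k ∸_) (interval (suc a) n)) k∸a))
  (trans (prep (b + n) (interval-reverse k (suc a) b n
    (≡-trans (+-suc (b + n) a) (≡-trans (cong (_+ a) (sym (+-suc b n))) eq))))
    (↭-sym (interval-last b n)))
  where
  k∸a : k ∸ a ≡ b + n
  k∸a = ≡-trans (cong (_∸ a) (suc-injective (≡-trans (sym eq) (cong (_+ a) (+-suc b n)))))
    (m+n∸n≡m (b + n) a)

∈-interval⁻ : ∀ {i} a n → i ∈ interval a n → a ≤ i × i < a + n
∈-interval⁻ a (suc n) (here refl) = ≤-refl , m<m+n a (s≤s z≤n)
∈-interval⁻ a (suc n) (there i∈) with ∈-interval⁻ (suc a) n i∈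
... | a<i , i<a+n = <⇒≤ a<i , ≤-trans i<a+n (≤-reflexive (sym (+-suc a n)))

∈-grid⁻ : ∀ {i j} a n m → (i , j) ∈ grid a n m → (a ≤ i × i < a + n) × j < m
∈-grid⁻ a n m ij∈ with ∈-cartesianProduct⁻ (interval a n) (interval 0 m) ij∈
... | i∈ , j∈ = ∈-interval⁻ a n i∈ , proj₂ (∈-interval⁻ 0 m j∈)

grid-++ : ∀ a n n′ m → grid a (n + n′) m ≡ grid a n m ++ grid (a + n) n′ m
grid-++ a n n′ m = ≡-trans (cong (λ xs → cartesianProduct xs (interval 0 m)) (interval-++ a n n′))
  (cartesianProductWith-distribʳ-++ _,_ (interval a n) (interval (a + n) n′) (interval 0 m))

cartesianProduct-map₁ : ∀ {Z : Set} (f : X → Y) xs (zs : List Z) →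
  cartesianProduct (map f xs) zs ≡ map (map₁ f) (cartesianProduct xs zs)
cartesianProduct-map₁ f []       zs = refl
cartesianProduct-map₁ f (x ∷ xs) zs = begin
  map (f x ,_) zs ++ cartesianProduct (map f xs) zs
    ≡⟨ cong₂ _++_ (map-∘ zs) (cartesianProduct-map₁ f xs zs) ⟩
  map (map₁ f) (map (x ,_) zs) ++ map (map₁ f) (cartesianProduct xs zs)
    ≡⟨ map-++ (map₁ f) (map (x ,_) zs) _ ⟨
  map (map₁ f) (map (x ,_) zs ++ cartesianProduct xs zs) ∎

cartesianProduct-↭ˡ : ∀ {xs ys : List X} (zs : List Y) → xs ↭ ys →
  cartesianProduct xs zs ↭ cartesianProduct ys zs
cartesianProduct-↭ˡ zs refl        = refl
cartesianProduct-↭ˡ zs (prep x p)  = ++⁺ˡ (map (x ,_) zs) (cartesianProduct-↭ˡ zs p)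
cartesianProduct-↭ˡ {xs = _ ∷ _ ∷ xs} zs (swap x y p) =
  trans (++⁺ˡ (map (x ,_) zs) (++⁺ˡ (map (y ,_) zs) (cartesianProduct-↭ˡ zs p)))
        (shifts (map (x ,_) zs) (map (y ,_) zs))
cartesianProduct-↭ˡ zs (trans p q) = trans (cartesianProduct-↭ˡ zs p) (cartesianProduct-↭ˡ zs q)

grid-reflection : ∀ s m → map (map₁ (s + s ∸_)) (grid 0 s m) ↭ grid (suc s) s m
grid-reflection s m = trans
  (↭-reflexive (sym (cartesianProduct-map₁ (s + s ∸_) (interval 0 s) (interval 0 m))))
  (cartesianProduct-↭ˡ (interval 0 m) (interval-reverse (s + s) 0 (suc s) s (+-identityʳ _)))

≡ᵇ-cong : ∀ m n p q → (m ≡ n → p ≡ q) → (p ≡ q → m ≡ n) → (m ≡ᵇ n) ≡ (p ≡ᵇ q)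
≡ᵇ-cong m n p q f g = ⇔→≡ (mk⇔
  (λ eq → ≡⇒≡ᵇ-true (f (≡ᵇ-sound m n eq))) (λ eq → ≡⇒≡ᵇ-true (g (≡ᵇ-sound p q eq))))
  where
  ≡⇒≡ᵇ-true : ∀ {m n} → m ≡ n → (m ≡ᵇ n) ≡ true
  ≡⇒≡ᵇ-true {m} refl = ≡ᵇ-refl m

adj₁-sym : ∀ i j → adj₁ i j ≡ adj₁ j i
adj₁-sym i j = xor-comm (suc i ≡ᵇ j) (suc j ≡ᵇ i)

adj-sym : ∀ v w → adj v w ≡ adj w v
adj-sym (i , j) (i′ , j′) = cong₂ _xor_
  (cong₂ _∧_ (≡ᵇ-sym i i′) (adj₁-sym j j′)) (cong₂ _∧_ (≡ᵇ-sym j j′) (adj₁-sym i i′))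

adj-loopless : ∀ v → adj v v ≡ false
adj-loopless (i , j) = cong₂ _xor_
  (≡-trans (cong ((i ≡ᵇ i) ∧_) (xor-same (suc j ≡ᵇ j))) (∧-zeroʳ _))
  (≡-trans (cong ((j ≡ᵇ j) ∧_) (xor-same (suc i ≡ᵇ i))) (∧-zeroʳ _))

cone-sym : ∀ {A : X → X → Bool} → (∀ x y → A x y ≡ A y x) → ∀ x y → cone A x y ≡ cone A y x
cone-sym A-sym nothing  nothing  = refl
cone-sym A-sym nothing  (just _) = refl
cone-sym A-sym (just _) nothing  = refl
cone-sym A-sym (just x) (just y) = A-sym x y

cone-loopless : ∀ {A : X → X → Bool} → (∀ x → A x x ≡ false) → ∀ x → cone A x x ≡ false
cone-loopless A-loopless nothing  = refl
cone-loopless A-loopless (just x) = A-loopless x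

adj₁-apart : ∀ {i j} → suc i < j → adj₁ i j ≡ false
adj₁-apart {i} {j} lt = cong₂ _xor_
  (≢⇒≡ᵇ-false (suc i) j (<⇒≢ lt)) (≢⇒≡ᵇ-false (suc j) i (>⇒≢ (m<n⇒m<1+n (<-trans (n<1+n i) lt))))

adj-apart : ∀ {i i′} j j′ → suc i < i′ → adj (i , j) (i′ , j′) ≡ false
adj-apart {i} {i′} j j′ lt = cong₂ _xor_
  (cong (_∧ adj₁ j j′) (≢⇒≡ᵇ-false i i′ (<⇒≢ (<-trans (n<1+n i) lt))))
  (≡-trans (cong ((j ≡ᵇ j′) ∧_) (adj₁-apart lt)) (∧-zeroʳ _))

-- Equality of the two sums expresses that `u` and `u′` are the images of `i` and `i′` under one
-- reflection.
adj₁-reflection : ∀ {i u i′ u′} → i + u ≡ i′ + u′ → adj₁ u u′ ≡ adj₁ i i′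
adj₁-reflection {i} {u} {i′} {u′} eq =
  ≡-trans (cong₂ _xor_ (flip i i′ eq) (flip i′ i (sym eq))) (xor-comm (suc i′ ≡ᵇ i) (suc i ≡ᵇ i′))
  where
  flip : ∀ i i′ {u u′} → i + u ≡ i′ + u′ → (suc u ≡ᵇ u′) ≡ (suc i′ ≡ᵇ i)
  flip i i′ {u} {u′} eq = ≡ᵇ-cong (suc u) u′ (suc i′) i
    (λ { refl → sym (+-cancelʳ-≡ u i (suc i′) (≡-trans eq (+-suc i′ u))) })
    (λ { refl → +-cancelˡ-≡ i′ (suc u) u′ (≡-trans (+-suc i′ u) eq) })

adj-reflection : ∀ i u i′ u′ j j′ → i + u ≡ i′ + u′ → adj (u , j) (u′ , j′) ≡ adj (i , j) (i′ , j′)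
adj-reflection i u i′ u′ j j′ eq = cong₂ _xor_
  (cong (_∧ adj₁ j j′) (≡ᵇ-cong u u′ i i′
    (λ { refl → +-cancelʳ-≡ u i i′ eq }) (λ { refl → +-cancelˡ-≡ i u u′ eq })))
  (cong ((j ≡ᵇ j′) ∧_) (adj₁-reflection {i} {u} {i′} {u′} eq))

-- Matchings of a path and of the cone over it.

-- The end vertex `a` has only one neighbour among the later vertices. Leaving `f` arbitrary allows
-- the apex to be carried along in it.
path-expand : ∀ a n (f : List (Maybe ℕ) → Bool) →
  sumPicks (map just (interval (suc a) (suc n))) (λ y ys → cone adj₁ (just a) y ∧ f ys) ≡
  f (map just (interval (2 + a) n))
path-expand a n f = ≡-trans
  (cong₂ _xor_ (cong (_∧ f rest) adj₁-suc) (sumPicks-false rest (λ y ys p → far y ys (∈-resp-↭ p (here refl)))))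
  (xor-identityʳ (f rest))
  where
  rest = map just (interval (2 + a) n)

  adj₁-suc : adj₁ a (suc a) ≡ true
  adj₁-suc = cong₂ _xor_ (≡ᵇ-refl a) (≢⇒≡ᵇ-false (2 + a) a (>⇒≢ (m<n⇒m<1+n (n<1+n a))))

  far : ∀ y ys → y ∈ rest → cone adj₁ (just a) y ∧ f (just (suc a) ∷ ys) ≡ false
  far y ys y∈ with ∈-map⁻ just y∈
  ... | b , b∈ , refl =
    cong (_∧ f (just (suc a) ∷ ys)) (adj₁-apart (proj₁ (∈-interval⁻ (2 + a) n b∈)))

even-path : ∀ a k → Pf (cone adj₁) (map just (interval a (k * 2))) ≡ true
even-path a zero    = refl
even-path a (suc k) = begin
  Pf (cone adj₁) (just a ∷ map just (interval (suc a) (suc (k * 2))))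
    ≡⟨ Pf-∷ (cone adj₁) (just a) (map just (interval (suc a) (suc (k * 2)))) ⟩
  sumPicks (map just (interval (suc a) (suc (k * 2)))) (λ y ys → cone adj₁ (just a) y ∧ Pf (cone adj₁) ys)
    ≡⟨ path-expand a (k * 2) (Pf (cone adj₁)) ⟩
  Pf (cone adj₁) (map just (interval (2 + a) (k * 2)))
    ≡⟨ even-path (2 + a) k ⟩
  true ∎

-- The value is `k + 1` modulo 2. The first vertex goes either to the apex, leaving an even path
-- with its unique perfect matching, or to its neighbour, leaving a path shorter by two.
odd-path : ∀ a k → Pf (cone adj₁) (nothing ∷ map just (interval a (suc (k * 2)))) ≡ not (odd k)
odd-path a zero    = refl
odd-path a (suc k) = begin
  Pf (cone adj₁) (nothing ∷ just a ∷ tail)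
    ≡⟨ Pfaffian.Pf-↭ (cone adj₁) (cone-sym adj₁-sym) (swap {xs = tail} nothing (just a) refl) ⟩
  Pf (cone adj₁) (just a ∷ nothing ∷ tail)
    ≡⟨ Pf-∷ (cone adj₁) (just a) (nothing ∷ tail) ⟩
  Pf (cone adj₁) tail xor
    sumPicks tail (λ y ys → cone adj₁ (just a) y ∧ Pf (cone adj₁) (nothing ∷ ys))
    ≡⟨ cong₂ _xor_ (even-path (suc a) (suc k))
         (path-expand a (suc (k * 2)) (λ ys → Pf (cone adj₁) (nothing ∷ ys))) ⟩
  true xor Pf (cone adj₁) (nothing ∷ map just (interval (2 + a) (suc (k * 2))))
    ≡⟨ cong not (odd-path (2 + a) k) ⟩
  not (not (odd k)) ∎
  where
  tail = map just (interval (suc a) (2 + k * 2))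

Pf-line : ∀ s m → Pf (cone adj) (nothing ∷ map just (grid s 1 m)) ≡
  Pf (cone adj₁) (nothing ∷ map just (interval 0 m))
Pf-line s m = begin
  Pf (cone adj) (nothing ∷ map just (grid s 1 m))
    ≡⟨ cong (λ xs → Pf (cone adj) (nothing ∷ xs))
         (≡-trans (cong (map just) (++-identityʳ (map (s ,_) (interval 0 m))))
           (≡-trans (sym (map-∘ (interval 0 m))) (map-∘ (interval 0 m)))) ⟩
  Pf (cone adj) (map (Maybe.map (s ,_)) (nothing ∷ map just (interval 0 m)))
    ≡⟨ Pf-map (cone adj) (Maybe.map (s ,_)) (nothing ∷ map just (interval 0 m)) ⟩
  Pf (λ x y → cone adj (Maybe.map (s ,_) x) (Maybe.map (s ,_) y)) (nothing ∷ map just (interval 0 m))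
    ≡⟨ Pf-cong (nothing ∷ map just (interval 0 m)) (λ {x} {y} _ _ → same x y) ⟩
  Pf (cone adj₁) (nothing ∷ map just (interval 0 m)) ∎
  where
  same : ∀ x y → cone adj (Maybe.map (s ,_) x) (Maybe.map (s ,_) y) ≡ cone adj₁ x y
  same nothing  nothing   = refl
  same nothing  (just _)  = refl
  same (just _) nothing   = refl
  same (just j) (just j′) = ≡-trans
    (cong₂ _xor_ (cong (_∧ adj₁ j j′) (≡ᵇ-refl s))
      (≡-trans (cong ((j ≡ᵇ j′) ∧_) (xor-same (suc s ≡ᵇ s))) (∧-zeroʳ _)))
    (xor-identityʳ _)

-- From the cone over the grid to a grid determinant.

gridDet : ℕ → ℕ → Bool
gridDet n m = Det adj (grid 0 n m) (grid 0 n m)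

-- The rows split into `s` rows, the axis of the reflection, and `s` mirror rows. The apex belongs
-- to the middle part, as it is joined to a vertex and to its mirror image alike.
nearPerfectCount-gridDet : ∀ s k →
  odd (nearPerfectCount (s + suc s) (suc (k * 2))) ≡ gridDet s (suc (k * 2)) ∧ not (odd k)
nearPerfectCount-gridDet s k = begin
  odd (nearPerfectCount (s + suc s) m)
    ≡⟨ nearPerfectCount-Pf (s + suc s) m ⟩
  Pf (cone adj) (nothing ∷ map just (vertices (s + suc s) m))
    ≡⟨ cong (λ vs → Pf (cone adj) (nothing ∷ map just vs)) split ⟩
  Pf (cone adj) (nothing ∷ map just (grid 0 s m ++ grid s 1 m ++ grid (suc s) s m))
    ≡⟨ Pfaffian.Pf-↭ (cone adj) (cone-sym adj-sym) arrange ⟩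
  Pf (cone adj) (left ++ map σ left ++ middle)
    ≡⟨ Reflection.Pf-reflection (cone adj) (cone-sym adj-sym) (cone-loopless adj-loopless) σ
         left middle iso far mid ⟩
  Det (cone adj) left left ∧ Pf (cone adj) middle
    ≡⟨ cong₂ _∧_ (Det-map (cone adj) just just (grid 0 s m) (grid 0 s m))
         (≡-trans (Pf-line s m) (odd-path 0 k)) ⟩
  gridDet s m ∧ not (odd k) ∎
  where
  m = suc (k * 2)
  σ = Maybe.map (map₁ {C = ℕ} (s + s ∸_))
  left = map just (grid 0 s m)
  middle = nothing ∷ map just (grid s 1 m)

  split : vertices (s + suc s) m ≡ grid 0 s m ++ grid s 1 m ++ grid (suc s) s m
  split = ≡-trans (vertices-grid (s + suc s) m) (≡-trans (grid-++ 0 s (suc s) m)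
    (cong (grid 0 s m ++_) (≡-trans (grid-++ s 1 s m)
      (cong (λ b → grid s 1 m ++ grid b s m) (+-comm s 1)))))

  arrange : nothing ∷ map just (grid 0 s m ++ grid s 1 m ++ grid (suc s) s m) ↭ left ++ map σ left ++ middle
  arrange = trans
    (prep nothing (↭-reflexive (≡-trans (map-++ just (grid 0 s m) _)
      (cong (left ++_) (map-++ just (grid s 1 m) _)))))
    (trans (↭-sym (shift nothing left _))
      (++⁺ˡ left (trans (++-comm middle (map just (grid (suc s) s m))) (++⁺ʳ middle (trans
        (map⁺ just (↭-sym (grid-reflection s m)))
        (↭-reflexive (≡-trans (sym (map-∘ (grid 0 s m))) (map-∘ (grid 0 s m)))))))))

  mirror : ∀ {i} → i < s → i + (s + s ∸ i) ≡ s + s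
  mirror i<s = m+[n∸m]≡n (≤-trans (<⇒≤ i<s) (m≤m+n s s))

  beyond : ∀ {i} → i < s → s < s + s ∸ i
  beyond {i} i<s = +-cancelˡ-< s s (s + s ∸ i)
    (≤-trans (≤-reflexive (cong suc (sym (mirror i<s)))) (+-monoˡ-≤ (s + s ∸ i) i<s))

  iso : ∀ {x y} → x ∈ left → y ∈ left → cone adj (σ x) (σ y) ≡ cone adj x y
  iso x∈ y∈ with ∈-map⁻ just x∈ | ∈-map⁻ just y∈
  ... | (i , j) , v∈ , refl | (i′ , j′) , w∈ , refl = adj-reflection i (s + s ∸ i) i′ (s + s ∸ i′) j j′
    (≡-trans (mirror (proj₂ (proj₁ (∈-grid⁻ 0 s m v∈)))) (sym (mirror (proj₂ (proj₁ (∈-grid⁻ 0 s m w∈))))))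

  far : ∀ {x y} → x ∈ left → y ∈ left → cone adj x (σ y) ≡ false
  far x∈ y∈ with ∈-map⁻ just x∈ | ∈-map⁻ just y∈
  ... | (i , j) , v∈ , refl | (i′ , j′) , w∈ , refl = adj-apart j j′
    (≤-<-trans (proj₂ (proj₁ (∈-grid⁻ 0 s m v∈))) (beyond (proj₂ (proj₁ (∈-grid⁻ 0 s m w∈)))))

  mid : ∀ {x y} → x ∈ left → y ∈ middle → cone adj (σ x) y ≡ cone adj x y
  mid x∈ (here refl) with ∈-map⁻ just x∈
  ... | _ , _ , refl = refl
  mid x∈ (there y∈) with ∈-map⁻ just x∈ | ∈-map⁻ just y∈
  ... | (i , j) , v∈ , refl | (i′ , j′) , w∈ , refl with proj₁ (∈-grid⁻ s 1 m w∈)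
  ...   | s≤i′ , i′<s+1 with ≤-antisym s≤i′ (≤-pred (≤-trans i′<s+1 (≤-reflexive (+-comm s 1))))
  ...     | refl = adj-reflection i (s + s ∸ i) s s j j′ (mirror (proj₂ (proj₁ (∈-grid⁻ 0 s m v∈))))

-- Solutions of the neighbour-sum equation

module Triangle (M i : ℕ) where

  -- Closed form, for 0 < i < M, of the solution of f (k + 1) = P f k + f (k - 1) with f 0 = 0 and
  -- f 1 = e_i, where P is the adjacency matrix mod 2 of the path on the vertices 1, ..., M - 1.
  triangle : ℕ → ℕ → Bool
  triangle a k = odd (a + k + i) ∧
    (((a <ᵇ k + i) ∧ (k <ᵇ a + i)) ∧ ((i <ᵇ a + k) ∧ (a + k + i <ᵇ M + M)))

  triangle-true : ∀ a k → triangle a k ≡ true →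
    (a < k + i × k < a + i) × (i < a + k × a + k + i < M + M)
  triangle-true a k eq with odd (a + k + i)
    | a <ᵇ k + i in eq₁ | k <ᵇ a + i in eq₂ | i <ᵇ a + k in eq₃ | a + k + i <ᵇ M + M in eq₄
  ... | true | true | true | true | true = (lt eq₁ , lt eq₂) , (lt eq₃ , lt eq₄)
    where
    lt : ∀ {m n} → (m <ᵇ n) ≡ true → m < n
    lt {m} {n} eq = <ᵇ⇒< m n (Equivalence.from T-≡ eq)

  triangle-zeroʳ : ∀ a → triangle a 0 ≡ false
  triangle-zeroʳ a = ¬-not λ eq → let (a<i , _) , (i<a , _) = triangle-true a 0 eq in
    <-asym a<i (<-≤-trans i<a (≤-reflexive (+-identityʳ a)))

  triangle-zeroˡ : ∀ k → triangle 0 k ≡ false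
  triangle-zeroˡ k = ¬-not λ eq → let (_ , k<i) , (i<k , _) = triangle-true 0 k eq in <-asym k<i i<k

  triangle-boundˡ : ∀ k → triangle M k ≡ false
  triangle-boundˡ k = ¬-not λ eq → let (M<k+i , _) , (_ , lt) = triangle-true M k eq in
    <-asym M<k+i (+-cancelˡ-< M (k + i) M (≤-trans (s≤s (≤-reflexive (sym (+-assoc M k i)))) lt))

  -- This is the annihilation of the path by the Chebyshev polynomial: the recursion returns to zero
  -- at step `M`, so a solution may end at the last row of the grid.
  triangle-boundʳ : ∀ a → triangle a M ≡ false
  triangle-boundʳ a = ¬-not λ eq → let (_ , M<a+i) , (_ , lt) = triangle-true a M eq in
    <-asym M<a+i (+-cancelˡ-< M (a + i) M (≤-trans (s≤s (≤-reflexive (≡-trans (sym (+-assoc M a i))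
      (cong (_+ i) (+-comm M a))))) lt))

double-injective : ∀ m n → m + m ≡ n + n → m ≡ n
double-injective zero    zero    eq = refl
double-injective (suc m) (suc n) eq = cong suc (double-injective m n
  (suc-injective (≡-trans (sym (+-suc m m)) (≡-trans (suc-injective eq) (+-suc n n)))))

odd-+-double : ∀ n m → odd (n + (m + m)) ≡ odd n
odd-+-double n zero    = cong odd (+-identityʳ n)
odd-+-double n (suc m) = ≡-trans (cong odd (≡-trans (+-suc n (m + suc m)) (cong suc
  (≡-trans (cong (n +_) (+-suc m m)) (+-suc n (m + m)))))) (≡-trans (not-involutive _) (odd-+-double n m))

-- The initial condition f 1 = e_i, with columns counted from 0 as in the grid.
triangle-one : ∀ m i a → i < m → Triangle.triangle (suc m) (suc i) (suc a) 1 ≡ (a ≡ᵇ i)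
triangle-one m i a i<m with a ≡ᵇ i in eq
... | true with refl ← ≡ᵇ-sound a i eq = begin
  odd (suc a + 1 + suc a) ∧ (((a <ᵇ suc a) ∧ (0 <ᵇ a + suc a)) ∧
    ((a <ᵇ a + 1) ∧ (suc a + 1 + suc a <ᵇ suc m + suc m)))
    ≡⟨ cong₂ _∧_ odd-bit (cong₂ _∧_ (cong₂ _∧_ (lt (n<1+n a)) (lt (≤-trans (s≤s z≤n) (m≤n+m (suc a) a))))
         (cong₂ _∧_ (lt (m<m+n a (s≤s z≤n))) (lt bound))) ⟩
  true ∎
  where
  lt : ∀ {m n} → m < n → (m <ᵇ n) ≡ true
  lt p = Equivalence.to T-≡ (<⇒<ᵇ p)
  shape : suc a + 1 + suc a ≡ suc (suc a + suc a)
  shape = cong suc (cong (_+ suc a) (+-comm a 1))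
  odd-bit : odd (suc a + 1 + suc a) ≡ true
  odd-bit = ≡-trans (cong odd shape) (cong not (odd-+-double 0 (suc a)))
  bound : suc a + 1 + suc a < suc m + suc m
  bound = ≤-trans (s≤s (≤-reflexive shape)) (≤-trans
    (≤-reflexive (cong (λ n → suc n) (sym (+-suc (suc a) (suc a)))))
    (+-mono-≤ (s≤s i<m) (s≤s i<m)))
... | false = ¬-not λ tri → let (a<i , _) , (i<a , _) = Triangle.triangle-true (suc m) (suc i) (suc a) 1 tri in
  false≢true (≡-trans (sym eq) (≡-trans (cong (_≡ᵇ i) (≤-antisym (≤-pred (≤-pred a<i))
    (≤-pred (≤-pred (≤-trans i<a (≤-reflexive (+-comm (suc a) 1))))))) (≡ᵇ-refl i)))

-- The two comparisons differ only if `i` is `x` or `suc x`; the parity excludes the former, the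
-- inequality the latter.
lt-skip : ∀ i x → odd (suc x + i) ≡ false → suc x ≢ i → (i <ᵇ x) ≡ (i <ᵇ 2 + x)
lt-skip zero          (suc x) even neq = refl
lt-skip (suc zero)    zero    even neq = ⊥-elim (neq refl)
lt-skip (suc (suc i)) zero    even neq = refl
lt-skip (suc i)       (suc x) even neq = lt-skip i x
  (≡-trans (sym (not-involutive _)) (≡-trans (cong (not ∘ odd) (sym (+-suc (suc x) i))) even))
  (neq ∘ cong suc)

skip-lt : ∀ x i → odd (suc x + i) ≡ false → suc x ≢ i → (x <ᵇ i) ≡ (2 + x <ᵇ i)
skip-lt x       zero                even neq = refl
skip-lt zero    (suc zero)          even neq = ⊥-elim (neq refl)
skip-lt zero    (suc (suc (suc i))) even neq = refl
skip-lt (suc x) (suc i)             even neq = skip-lt x i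
  (≡-trans (sym (not-involutive _)) (≡-trans (cong (not ∘ odd) (sym (+-suc (suc x) i))) even))
  (neq ∘ cong suc)

-- In the coordinates a + k and a - k the triangle function is a product of two interval indicators,
-- so the sum over the four neighbours factors as well; away from the boundary one factor vanishes.
triangle-harmonic : ∀ M i a k → suc a < M → suc k < M → let open Triangle M i in
  (triangle a (suc k) xor triangle (2 + a) (suc k)) xor (triangle (suc a) k xor triangle (suc a) (2 + k)) ≡ false
triangle-harmonic M i a k a<M k<M rewrite +-suc a (suc k) | +-suc a k with odd (a + k + i) in eq
-- The four neighbours share one parity, which is the wrong one here, so all four values vanish.
... | true  = refl
... | false = ≡-trans (factor Y₁ Y₂ X₁ X₂) cases
  where
  x = a + k
  X₁ = (i <ᵇ 1 + x) ∧ (1 + x + i <ᵇ M + M)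
  X₂ = (i <ᵇ 3 + x) ∧ (3 + x + i <ᵇ M + M)
  Y₁ = (a <ᵇ suc k + i) ∧ (suc k <ᵇ a + i)
  Y₂ = (2 + a <ᵇ suc k + i) ∧ (suc k <ᵇ 2 + a + i)

  factor : ∀ y₁ y₂ x₁ x₂ →
    ((y₁ ∧ x₁) xor (y₂ ∧ x₂)) xor ((y₂ ∧ x₁) xor (y₁ ∧ x₂)) ≡ (y₁ xor y₂) ∧ (x₁ xor x₂)
  factor true  true  true  true  = refl
  factor true  true  true  false = refl
  factor true  true  false true  = refl
  factor true  true  false false = refl
  factor true  false x₁    x₂    = cong (_xor x₂) (xor-identityʳ x₁)
  factor false true  x₁    x₂    =
    ≡-trans (cong (x₂ xor_) (xor-identityʳ x₁)) (xor-comm x₂ x₁)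
  factor false false x₁    x₂    = refl

  even : ∀ {n} → n ≡ 2 + x + i → odd n ≡ false
  even refl = ≡-trans (not-involutive _) eq

  X-equal : 2 + x ≢ i → 2 + x + i ≢ M + M → X₁ ≡ X₂
  X-equal p q = cong₂ _∧_ (lt-skip i (1 + x) (even refl) p)
    (skip-lt (1 + x + i) (M + M) (≡-trans (odd-+-double (2 + x + i) M) (even refl)) q)

  Y-equal : suc a ≢ suc k + i → suc (a + i) ≢ suc k → Y₁ ≡ Y₂
  Y-equal p q = cong₂ _∧_
    (skip-lt a (suc k + i) (even (cong suc (≡-trans (+-suc a (k + i)) (cong suc (sym (+-assoc a k i)))))) p)
    (lt-skip (suc k) (a + i) (even (cong suc (≡-trans (+-suc (a + i) k) (cong suc
      (≡-trans (+-assoc a i k) (≡-trans (cong (a +_) (+-comm i k)) (sym (+-assoc a k i)))))))) q)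

  absurd₁ : ∀ a k → k + (2 + (a + k)) ≢ a
  absurd₁ a k eq = m+1+n≢m a (≡-trans (lemma a k) eq)
    where
    lemma : ∀ a k → a + suc (k + suc k) ≡ k + (2 + (a + k))
    lemma a k = begin
      a + suc (k + suc k)     ≡⟨ +-suc a (k + suc k) ⟩
      suc (a + (k + suc k))   ≡⟨ cong suc (+-comm a (k + suc k)) ⟩
      suc (k + suc k + a)     ≡⟨ cong suc (+-assoc k (suc k) a) ⟩
      suc (k + (suc k + a))   ≡⟨ +-suc k (suc k + a) ⟨
      k + (2 + (k + a))       ≡⟨ cong (λ n → k + (2 + n)) (+-comm k a) ⟩
      k + (2 + (a + k)) ∎

  corner : ∀ m → 2 + (m + m) ≡ M + M → suc m < M → ⊥
  corner m eq lt = <⇒≢ lt (double-injective (suc m) M (≡-trans (cong suc (+-suc m m)) eq))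

  X-zero : X₁ ≡ X₂ → (Y₁ xor Y₂) ∧ (X₁ xor X₂) ≡ false
  X-zero eq = ≡-trans (cong (λ b → (Y₁ xor Y₂) ∧ (X₁ xor b)) (sym eq))
    (≡-trans (cong ((Y₁ xor Y₂) ∧_) (xor-same X₁)) (∧-zeroʳ _))

  Y-zero : Y₁ ≡ Y₂ → (Y₁ xor Y₂) ∧ (X₁ xor X₂) ≡ false
  Y-zero eq = ≡-trans (cong (λ b → (Y₁ xor b) ∧ (X₁ xor X₂)) (sym eq)) (cong (_∧ (X₁ xor X₂)) (xor-same Y₁))

  cases : (Y₁ xor Y₂) ∧ (X₁ xor X₂) ≡ false
  -- A factor is nonzero only if the centre `(suc a , suc k)` lies on a side line of the tilted
  -- rectangle in the corresponding direction. Both are nonzero only at a corner, and each corner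
  -- has a coordinate 0 or `M`, which the bounds on the centre rule out.
  cases with 2 + x ≟ i | 2 + x + i ≟ M + M | suc a ≟ suc k + i | suc (a + i) ≟ suc k
  ... | no p     | no q  | _     | _     = X-zero (X-equal p q)
  ... | _        | _     | no p  | no q  = Y-zero (Y-equal p q)
  ... | yes p    | _     | yes q | _     =
    ⊥-elim (absurd₁ a k (≡-trans (cong (k +_) p) (sym (suc-injective q))))
  ... | yes p    | _     | no _  | yes q =
    ⊥-elim (absurd₁ k a (≡-trans (cong (a +_) (≡-trans (cong (2 +_) (+-comm k a)) p)) (suc-injective q)))
  ... | no _     | yes p | yes q | _     = ⊥-elim (corner a (≡-trans (cong (2 +_)
    (≡-trans (cong (a +_) (suc-injective q)) (sym (+-assoc a k i)))) p) a<M)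
  ... | no _     | yes p | no _  | yes q = ⊥-elim (corner k (≡-trans (cong (2 +_)
    (≡-trans (cong (_+ k) (sym (suc-injective q))) (≡-trans (+-assoc a i k)
      (≡-trans (cong (a +_) (+-comm i k)) (sym (+-assoc a k i)))))) p) k<M)

-- Neighbour sums on the path and on the grid.

sum-interval-pick : ∀ c n b (h : ℕ → Bool) → c ≤ b → b < c + n →
  sum (interval c n) (λ j → (j ≡ᵇ b) ∧ h j) ≡ h b
sum-interval-pick c zero    b h c≤b b<c = ⊥-elim (<⇒≱ b<c (≤-trans (≤-reflexive (+-identityʳ c)) c≤b))
sum-interval-pick c (suc n) b h c≤b b<c+n with c ≟ b
... | yes refl = ≡-trans
  (cong₂ _xor_ (cong (_∧ h c) (≡ᵇ-refl c)) (sum-false (interval (suc c) n) (λ {j} j∈ →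
    cong (_∧ h j) (≢⇒≡ᵇ-false j c (>⇒≢ (proj₁ (∈-interval⁻ (suc c) n j∈)))))))
  (xor-identityʳ (h c))
... | no c≢b = cong₂ _xor_ (cong (_∧ h c) (≢⇒≡ᵇ-false c b c≢b))
  (sum-interval-pick (suc c) n b h (≤∧≢⇒< c≤b c≢b) (≤-trans b<c+n (≤-reflexive (+-suc c n))))

previous : (ℕ → Bool) → ℕ → Bool
previous g zero    = false
previous g (suc n) = g n

-- Zero values beyond both ends, by `previous` on the left and by `g n ≡ false` on the right, give
-- end vertices the same formula as inner ones.
sum-adj₁ : ∀ n (g : ℕ → Bool) b → b < n → g n ≡ false →
  sum (interval 0 n) (λ j → g j ∧ adj₁ j b) ≡ previous g b xor g (suc b)
sum-adj₁ n g b b<n end = begin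
  sum (interval 0 n) (λ j → g j ∧ adj₁ j b)
    ≡⟨ sum-cong (interval 0 n) (λ {j} _ →
         ≡-trans (∧-comm (g j) (adj₁ j b)) (∧-distribʳ-xor (g j) (suc j ≡ᵇ b) _)) ⟩
  sum (interval 0 n) (λ j → ((suc j ≡ᵇ b) ∧ g j) xor ((suc b ≡ᵇ j) ∧ g j))
    ≡⟨ sum-xor (interval 0 n) _ _ ⟩
  sum (interval 0 n) (λ j → (suc j ≡ᵇ b) ∧ g j) xor sum (interval 0 n) (λ j → (suc b ≡ᵇ j) ∧ g j)
    ≡⟨ cong₂ _xor_ (before b b<n) after ⟩
  previous g b xor g (suc b) ∎
  where
  before : ∀ b → b < n → sum (interval 0 n) (λ j → (suc j ≡ᵇ b) ∧ g j) ≡ previous g b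
  before zero    _   = sum-false (interval 0 n) (λ _ → refl)
  before (suc b) b<n = sum-interval-pick 0 n b g z≤n (<-trans (n<1+n b) b<n)

  after : sum (interval 0 n) (λ j → (suc b ≡ᵇ j) ∧ g j) ≡ g (suc b)
  after with m≤n⇒m<n∨m≡n b<n
  ... | inj₁ b+1<n = ≡-trans
    (sum-cong (interval 0 n) (λ {j} _ → cong (_∧ g j) (≡ᵇ-sym (suc b) j)))
    (sum-interval-pick 0 n (suc b) g z≤n b+1<n)
  ... | inj₂ refl = ≡-trans
    (sum-false (interval 0 n) (λ {j} j∈ →
      cong (_∧ g j) (≢⇒≡ᵇ-false n j (>⇒≢ (proj₂ (∈-interval⁻ 0 n j∈))))))
    (sym end)

sum-adj : ∀ n m (f : Vertex → Bool) b a → b < n → a < m →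
  sum (grid 0 n m) (λ v → f v ∧ adj v (b , a)) ≡
  sum (interval 0 m) (λ a′ → f (b , a′) ∧ adj₁ a′ a) xor
  sum (interval 0 n) (λ b′ → f (b′ , a) ∧ adj₁ b′ b)
sum-adj n m f b a b<n a<m = begin
  sum (grid 0 n m) (λ v → f v ∧ adj v (b , a))
    ≡⟨ sum-cartesianProduct N M _ ⟩
  sum N (λ j → sum M (λ i → f (j , i) ∧ adj (j , i) (b , a)))
    ≡⟨ sum-cong N (λ {j} _ → ≡-trans (sum-cong M (λ {i} _ →
         ≡-trans (∧-distribˡ-xor (f (j , i)) _ _)
           (cong₂ _xor_ (∧-swap (f (j , i)) (j ≡ᵇ b) _) (∧-swap (f (j , i)) (i ≡ᵇ a) _))))
         (≡-trans (sum-xor M _ _) (cong₂ _xor_ (sum-∧ˡ M (j ≡ᵇ b) _)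
           (sum-interval-pick 0 m a (λ i → f (j , i) ∧ adj₁ j b) z≤n a<m)))) ⟩
  sum N (λ j → ((j ≡ᵇ b) ∧ sum M (λ i → f (j , i) ∧ adj₁ i a)) xor (f (j , a) ∧ adj₁ j b))
    ≡⟨ sum-xor N _ _ ⟩
  sum N (λ j → (j ≡ᵇ b) ∧ sum M (λ i → f (j , i) ∧ adj₁ i a)) xor sum N (λ j → f (j , a) ∧ adj₁ j b)
    ≡⟨ cong (_xor sum N (λ j → f (j , a) ∧ adj₁ j b))
         (sum-interval-pick 0 n b (λ j → sum M (λ i → f (j , i) ∧ adj₁ i a)) z≤n b<n) ⟩
  sum M (λ i → f (b , i) ∧ adj₁ i a) xor sum N (λ j → f (j , a) ∧ adj₁ j b) ∎
  where
  N = interval 0 n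
  M = interval 0 m

interval-unique : ∀ a n → Unique (interval a n)
interval-unique a zero    = []
interval-unique a (suc n) =
  All.tabulate (λ i∈ → <⇒≢ (proj₁ (∈-interval⁻ (suc a) n i∈))) ∷ interval-unique (suc a) n

module _ (t m : ℕ) where

  -- Truncated subtraction makes the function vanish on all rows up to t.
  support : ℕ → Vertex → Bool
  support i (j , a) = Triangle.triangle (suc m) (suc i) (suc a) (j ∸ t)

  private
    -- Border vertices obey the formula for inner ones because the triangle function vanishes in
    -- column 0, in column `suc m` and in the row after the last.
    neighbours : ∀ i b a → b < t + suc m → a < m → let open Triangle (suc m) (suc i) in
      sum (grid 0 (t + suc m) m) (λ v → support i v ∧ adj v (b , a)) ≡
      (triangle a (b ∸ t) xor triangle (2 + a) (b ∸ t)) xor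
      (previous (λ j → triangle (suc a) (j ∸ t)) b xor triangle (suc a) (suc b ∸ t))
    neighbours i b a b<n a<m = ≡-trans (sum-adj (t + suc m) m (support i) b a b<n a<m)
      (cong₂ _xor_
        (≡-trans (sum-adj₁ m (λ a → triangle (suc a) (b ∸ t)) a a<m (triangle-boundˡ (b ∸ t)))
          (cong (_xor triangle (2 + a) (b ∸ t)) (shifted a)))
        (sum-adj₁ (t + suc m) (λ j → triangle (suc a) (j ∸ t)) b b<n
          (≡-trans (cong (triangle (suc a)) (m+n∸m≡n t (suc m))) (triangle-boundʳ (suc a)))))
      where
      open Triangle (suc m) (suc i)
      shifted : ∀ a → previous (λ a → triangle (suc a) (b ∸ t)) a ≡ triangle a (b ∸ t)
      shifted zero    = sym (triangle-zeroˡ (b ∸ t))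
      shifted (suc a) = refl

  sum-support-below : ∀ i b a → b < t → a < m →
    sum (grid 0 (t + suc m) m) (λ v → support i v ∧ adj v (b , a)) ≡ false
  sum-support-below i b a b<t a<m = ≡-trans (neighbours i b a (<-≤-trans b<t (m≤m+n t (suc m))) a<m)
    (cong₂ _xor_
      (≡-trans (cong (λ k → triangle a k xor triangle (2 + a) k) (m≤n⇒m∸n≡0 (<⇒≤ b<t)))
        (cong₂ _xor_ (triangle-zeroʳ a) (triangle-zeroʳ (2 + a))))
      (cong₂ _xor_ (before b b<t)
        (≡-trans (cong (triangle (suc a)) (m≤n⇒m∸n≡0 b<t)) (triangle-zeroʳ (suc a)))))
    where
    open Triangle (suc m) (suc i)
    before : ∀ b → b < t → previous (λ j → triangle (suc a) (j ∸ t)) b ≡ false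
    before zero    _   = refl
    before (suc b) b<t = ≡-trans (cong (triangle (suc a)) (m≤n⇒m∸n≡0 (<⇒≤ (<⇒≤ b<t)))) (triangle-zeroʳ (suc a))

  -- Of the rows next to and including row `t`, only row `suc t` carries a nonzero solution, and
  -- there it is the unit vector of `i`.
  sum-support-at : ∀ i a → i < m → a < m →
    sum (grid 0 (t + suc m) m) (λ v → support i v ∧ adj v (t , a)) ≡ (a ≡ᵇ i)
  sum-support-at i a i<m a<m = ≡-trans (neighbours i t a (m<m+n t (s≤s z≤n)) a<m)
    (cong₂ _xor_
      (≡-trans (cong (λ k → triangle a k xor triangle (2 + a) k) (n∸n≡0 t))
        (cong₂ _xor_ (triangle-zeroʳ a) (triangle-zeroʳ (2 + a))))
      (cong₂ _xor_ (before t ≤-refl)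
        (≡-trans (cong (triangle (suc a)) (m+n∸n≡m 1 t)) (triangle-one m i a i<m))))
    where
    open Triangle (suc m) (suc i)
    before : ∀ b → b ≤ t → previous (λ j → triangle (suc a) (j ∸ t)) b ≡ false
    before zero    _   = refl
    before (suc b) b<t = ≡-trans (cong (triangle (suc a)) (m≤n⇒m∸n≡0 (<⇒≤ b<t))) (triangle-zeroʳ (suc a))

  sum-support-above : ∀ i k a → k < m → a < m →
    sum (grid 0 (t + suc m) m) (λ v → support i v ∧ adj v (suc t + k , a)) ≡ false
  sum-support-above i k a k<m a<m = ≡-trans
    (neighbours i (suc t + k) a (≤-trans (s≤s (≤-reflexive (sym (+-suc t k))))
      (≤-trans (s≤s (+-monoʳ-≤ t k<m)) (≤-reflexive (sym (+-suc t m))))) a<m)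
    (≡-trans
      (cong₂ _xor_
        (cong (λ k → triangle a k xor triangle (2 + a) k)
          (≡-trans (cong (_∸ t) (sym (+-suc t k))) (m+n∸m≡n t (suc k))))
        (cong₂ _xor_ (cong (triangle (suc a)) (m+n∸m≡n t k))
          (cong (triangle (suc a)) (≡-trans
            (cong (_∸ t) (sym (≡-trans (+-suc t (suc k)) (cong suc (+-suc t k))))) (m+n∸m≡n t (2 + k))))))
      (triangle-harmonic (suc m) (suc i) a k (s≤s a<m) (s≤s k<m)))
    where
    open Triangle (suc m) (suc i)

-- Euclid's algorithm

-- The corrections use only rows of `xs`, which no pivot removes, so the conditions on the remaining
-- pivots persist after each of them.
Det-pivots : ∀ (A : X → Y → Bool) (v : ℕ → X) (u : ℕ → Y) (f : ℕ → X → Bool) is xs ys → Unique is →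
  (∀ {i j} → i ∈ is → j ∈ is → A (v i) (u j) xor sum xs (λ x → f i x ∧ A x (u j)) ≡ (j ≡ᵇ i)) →
  (∀ {i y} → i ∈ is → y ∈ ys → A (v i) y xor sum xs (λ x → f i x ∧ A x y) ≡ false) →
  Det A (map v is ++ xs) (map u is ++ ys) ≡ Det A xs ys
Det-pivots A v u f [] xs ys _ _ _ = refl
Det-pivots A v u f (i ∷ is) xs ys (i∉is ∷ unique) at off = ≡-trans
  (Det-pivot A (f i) (v i) (map v is ++ xs) xs (u i) (map u is ++ ys) (∈-++⁺ʳ (map v is))
    (≡-trans (at (here refl) (here refl)) (≡ᵇ-refl i)) others)
  (Det-pivots A v u f is xs ys unique
    (λ i∈ j∈ → at (there i∈) (there j∈)) (λ i∈ y∈ → off (there i∈) y∈))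
  where
  others : ∀ {y} → y ∈ map u is ++ ys → A (v i) y xor sum xs (λ x → f i x ∧ A x y) ≡ false
  others y∈ with ∈-++⁻ (map u is) y∈
  ... | inj₂ y∈ys = off (here refl) y∈ys
  ... | inj₁ y∈us with ∈-map⁻ u y∈us
  ...   | j , j∈ , refl = ≡-trans (at (here refl) (there j∈))
    (≢⇒≡ᵇ-false j i (λ j≡i → All.lookup i∉is j∈ (sym j≡i)))

line : ℕ → ℕ → List Vertex
line j m = map (j ,_) (interval 0 m)

grid-line : ∀ p q m → grid 0 (p + suc q) m ≡ grid 0 p m ++ (line p m ++ grid (suc p) q m)
grid-line p q m = grid-++ 0 p (suc q) m

grid-line-↭ : ∀ p q m → grid 0 (p + suc q) m ↭ line p m ++ (grid 0 p m ++ grid (suc p) q m)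
grid-line-↭ p q m = trans (↭-reflexive (grid-line p q m)) (shifts (grid 0 p m) (line p m))

interval-shift : ∀ k a n → interval (k + a) n ≡ map (k +_) (interval a n)
interval-shift k a zero    = refl
interval-shift k a (suc n) = cong (k + a ∷_)
  (≡-trans (cong (λ b → interval b n) (sym (+-suc k a))) (interval-shift k (suc a) n))

Det-grid-shift : ∀ k n m → Det adj (grid k n m) (grid k n m) ≡ gridDet n m
Det-grid-shift k n m = begin
  Det adj (grid k n m) (grid k n m)
    ≡⟨ cong (λ vs → Det adj vs vs) shifted ⟩
  Det adj (map (map₁ (k +_)) (grid 0 n m)) (map (map₁ (k +_)) (grid 0 n m))
    ≡⟨ Det-map adj (map₁ (k +_)) (map₁ (k +_)) (grid 0 n m) (grid 0 n m) ⟩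
  Det (λ v w → adj (map₁ (k +_) v) (map₁ (k +_) w)) (grid 0 n m) (grid 0 n m)
    ≡⟨ Det-cong (grid 0 n m) (grid 0 n m) (λ {v} {w} _ _ → invariant k v w) ⟩
  gridDet n m ∎
  where
  shifted : grid k n m ≡ map (map₁ (k +_)) (grid 0 n m)
  shifted = ≡-trans
    (cong (λ is → cartesianProduct is (interval 0 m))
      (≡-trans (cong (λ b → interval b n) (sym (+-identityʳ k))) (interval-shift k 0 n)))
    (cartesianProduct-map₁ (k +_) (interval 0 n) (interval 0 m))
  invariant : ∀ k v w → adj (map₁ (k +_) v) (map₁ (k +_) w) ≡ adj v w
  invariant zero    v w = refl
  invariant (suc k) v w = invariant k v w

adj-next : ∀ t i j → adj (t , i) (suc t , j) ≡ (j ≡ᵇ i)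
adj-next t i j = begin
  adj (t , i) (suc t , j)
    ≡⟨ cong₂ _xor_ (cong (_∧ adj₁ i j) (≢⇒≡ᵇ-false t (suc t) (<⇒≢ (n<1+n t))))
         (cong ((i ≡ᵇ j) ∧_) (cong₂ _xor_ (≡ᵇ-refl t)
           (≢⇒≡ᵇ-false (2 + t) t (>⇒≢ (m<n⇒m<1+n (n<1+n t)))))) ⟩
  (i ≡ᵇ j) ∧ true  ≡⟨ ∧-identityʳ (i ≡ᵇ j) ⟩
  (i ≡ᵇ j)         ≡⟨ ≡ᵇ-sym i j ⟩
  (j ≡ᵇ i) ∎

gridDet-step-suc : ∀ t m → gridDet (t + suc (suc m)) (suc m) ≡ gridDet t (suc m) ∧ gridDet m (suc m)
gridDet-step-suc t m = begin
  Det adj (grid 0 n M) (grid 0 n M)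
    ≡⟨ Det-↭ʳ adj (grid 0 n M) (grid-line-↭ t M M) ⟩
  Det adj (grid 0 n M) (line t M ++ (grid 0 t M ++ grid (suc t) M M))
    ≡⟨ Det-↭ˡ adj _ (trans (↭-reflexive (cong (λ k → grid 0 k M) (+-suc t M))) (grid-line-↭ (suc t) m M)) ⟩
  Det adj (line (suc t) M ++ rest) (line t M ++ (grid 0 t M ++ grid (suc t) M M))
    -- Row `(suc t , i)`, corrected by the rest of its support, becomes the unit vector of column
    -- `(t , i)`. Thus line `suc t` leaves the rows and line `t` leaves the columns.
    ≡⟨ Det-pivots adj (suc t ,_) (t ,_) (support t M) (interval 0 M) rest _ (interval-unique 0 M)
         (λ {i} {j} i∈ j∈ → ≡-trans (combine i (t , j) (proj₂ (∈-interval⁻ 0 M i∈)))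
           (sum-support-at t M i j (proj₂ (∈-interval⁻ 0 M i∈)) (proj₂ (∈-interval⁻ 0 M j∈))))
         (λ {i} {y} i∈ y∈ → ≡-trans (combine i y (proj₂ (∈-interval⁻ 0 M i∈)))
           (elsewhere i y (∈-++⁻ (grid 0 t M) y∈))) ⟩
  Det adj (grid 0 (suc t) M ++ far) (grid 0 t M ++ grid (suc t) M M)
    ≡⟨ cong (λ vs → Det adj vs (grid 0 t M ++ grid (suc t) M M)) regroup ⟩
  Det adj (grid 0 t M ++ (line t M ++ far)) (grid 0 t M ++ grid (suc t) M M)
    -- With line `t` gone from the columns, the rows before `t` have no neighbour among the later
    -- columns: the matrix is block triangular.
    ≡⟨ Det-++ adj (grid 0 t M) (line t M ++ far) (grid 0 t M) (grid (suc t) M M) refl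
         (λ { {i , a} {j , b} x∈ y∈ → adj-apart a b
           (≤-trans (s≤s (proj₂ (proj₁ (∈-grid⁻ 0 t M x∈)))) (proj₁ (proj₁ (∈-grid⁻ (suc t) M M y∈)))) }) ⟩
  gridDet t M ∧ Det adj (line t M ++ far) (line (suc t) M ++ far)
    ≡⟨ cong (gridDet t M ∧_) (≡-trans
         -- Two adjacent lines meet in an identity matrix and line `t` misses `far`, so these pivots
         -- have zero corrections.
         (Det-pivots adj (t ,_) (suc t ,_) (λ _ _ → false) (interval 0 M) far far (interval-unique 0 M)
           (λ {i} {j} _ _ → ≡-trans (cong (adj (t , i) (suc t , j) xor_) (sum-false far (λ _ → refl)))
             (≡-trans (xor-identityʳ _) (adj-next t i j)))
           (λ { {i} {j , a} _ y∈ → cong₂ _xor_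
             (adj-apart i a (proj₁ (proj₁ (∈-grid⁻ (2 + t) m M y∈)))) (sum-false far (λ _ → refl)) }))
         (Det-grid-shift (2 + t) m M)) ⟩
  gridDet t M ∧ gridDet m M ∎
  where
  M = suc m
  n = t + suc M
  far = grid (2 + t) m M
  rest = grid 0 (suc t) M ++ far

  regroup : grid 0 (suc t) M ++ far ≡ grid 0 t M ++ (line t M ++ far)
  regroup = ≡-trans
    (cong (_++ far) (≡-trans (cong (λ k → grid 0 k M) (+-comm 1 t))
      (≡-trans (grid-line t 0 M) (cong (grid 0 t M ++_) (++-identityʳ (line t M))))))
    (++-assoc (grid 0 t M) (line t M) far)

  -- On line `suc t` the support is just the pivot vertex, so pivot row plus correction is the
  -- neighbour sum over the whole grid.
  combine : ∀ i y → i < M →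
    adj (suc t , i) y xor sum rest (λ x → support t M i x ∧ adj x y) ≡
    sum (grid 0 n M) (λ x → support t M i x ∧ adj x y)
  combine i y i<M = begin
    adj (suc t , i) y xor sum rest g
      ≡⟨ cong₂ _xor_ (sym pivot-line) (sum-++ (grid 0 (suc t) M) far g) ⟩
    sum (line (suc t) M) g xor (sum (grid 0 (suc t) M) g xor sum far g)
      ≡⟨ xor-swap (sum (line (suc t) M) g) (sum (grid 0 (suc t) M) g) (sum far g) ⟩
    sum (grid 0 (suc t) M) g xor (sum (line (suc t) M) g xor sum far g)
      ≡⟨ cong (sum (grid 0 (suc t) M) g xor_) (sum-++ (line (suc t) M) far g) ⟨
    sum (grid 0 (suc t) M) g xor sum (line (suc t) M ++ far) g
      ≡⟨ sum-++ (grid 0 (suc t) M) (line (suc t) M ++ far) g ⟨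
    sum (grid 0 (suc t) M ++ (line (suc t) M ++ far)) g
      ≡⟨ cong (λ vs → sum vs g)
           (≡-trans (sym (grid-line (suc t) m M)) (cong (λ k → grid 0 k M) (sym (+-suc t M)))) ⟩
    sum (grid 0 n M) g ∎
    where
    g : Vertex → Bool
    g x = support t M i x ∧ adj x y
    pivot-line : sum (line (suc t) M) g ≡ adj (suc t , i) y
    pivot-line = begin
      sum (line (suc t) M) g
        ≡⟨ sum-map (suc t ,_) (interval 0 M) g ⟩
      sum (interval 0 M) (λ a → support t M i (suc t , a) ∧ adj (suc t , a) y)
        ≡⟨ sum-cong (interval 0 M) (λ {a} _ → cong (_∧ adj (suc t , a) y)
             (≡-trans (cong (Triangle.triangle (suc M) (suc i) (suc a)) (m+n∸n≡m 1 t)) (triangle-one M i a i<M))) ⟩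
      sum (interval 0 M) (λ a → (a ≡ᵇ i) ∧ adj (suc t , a) y)
        ≡⟨ sum-interval-pick 0 M i (λ a → adj (suc t , a) y) z≤n i<M ⟩
      adj (suc t , i) y ∎

  elsewhere : ∀ i y → _ → sum (grid 0 n M) (λ x → support t M i x ∧ adj x y) ≡ false
  elsewhere i (b , a) (inj₁ y∈) with ∈-grid⁻ 0 t M y∈
  ... | (_ , b<t) , a<M = sum-support-below t M i b a b<t a<M
  elsewhere i (b , a) (inj₂ y∈) with ∈-grid⁻ (suc t) M M y∈
  ... | (t<b , b<t+M) , a<M with m≤n⇒∃[o]m+o≡n t<b
  ...   | k , refl = sum-support-above t M i k a (+-cancelˡ-< (suc t) k M b<t+M) a<M

cartesianProduct-swap : ∀ (xs : List X) (ys : List Y) →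
  map Product.swap (cartesianProduct xs ys) ↭ cartesianProduct ys xs
cartesianProduct-swap []       ys = ↭-reflexive (sym (cartesianProductWith-zeroʳ _,_ ys))
cartesianProduct-swap (x ∷ xs) ys = trans
  (↭-reflexive (≡-trans (map-++ Product.swap (map (x ,_) ys) _)
    (cong (_++ map Product.swap (cartesianProduct xs ys)) (sym (map-∘ ys)))))
  (trans (++⁺ˡ (map (_, x) ys) (cartesianProduct-swap xs ys)) (column ys))
  where
  column : ∀ ys → map (_, x) ys ++ cartesianProduct ys xs ↭ cartesianProduct ys (x ∷ xs)
  column []       = refl
  column (y ∷ ys) = prep (y , x) (trans (shifts (map (_, x) ys) (map (y ,_) xs))
    (++⁺ˡ (map (y ,_) xs) (column ys)))

gridDet-comm : ∀ n m → gridDet n m ≡ gridDet m n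
gridDet-comm n m = begin
  gridDet n m
    ≡⟨ Det-cong (grid 0 n m) (grid 0 n m) (λ { {i , j} {i′ , j′} _ _ → xor-comm ((i ≡ᵇ i′) ∧ adj₁ j j′) _ }) ⟩
  Det (λ v w → adj (Product.swap v) (Product.swap w)) (grid 0 n m) (grid 0 n m)
    ≡⟨ Det-map adj Product.swap Product.swap (grid 0 n m) (grid 0 n m) ⟨
  Det adj (map Product.swap (grid 0 n m)) (map Product.swap (grid 0 n m))
    ≡⟨ Det-↭ˡ adj _ (cartesianProduct-swap (interval 0 n) (interval 0 m)) ⟩
  Det adj (grid 0 m n) (map Product.swap (grid 0 n m))
    ≡⟨ Det-↭ʳ adj (grid 0 m n) (cartesianProduct-swap (interval 0 n) (interval 0 m)) ⟩
  gridDet m n ∎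

-- After a transposition the reduction applies with `t = 0`, where the first factor is an empty
-- determinant.
gridDet-consecutive : ∀ m → gridDet m (suc m) ≡ true
gridDet-consecutive zero    = refl
gridDet-consecutive (suc m) = ≡-trans (gridDet-comm (suc m) (suc (suc m)))
  (≡-trans (gridDet-step-suc 0 m) (gridDet-consecutive m))

gridDet-zero : ∀ n → gridDet n 0 ≡ true
gridDet-zero n = cong (λ vs → Det adj vs vs) (cartesianProductWith-zeroʳ _,_ (interval 0 n))

gridDet-step : ∀ t m → gridDet (t + suc m) m ≡ gridDet t m
gridDet-step t zero    = ≡-trans (gridDet-zero (t + 1)) (sym (gridDet-zero t))
gridDet-step t (suc m) = ≡-trans (gridDet-step-suc t m)
  (≡-trans (cong (gridDet t (suc m) ∧_) (gridDet-consecutive m)) (∧-identityʳ _))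

-- The rows indexed by the diagonal of a square add up to zero.
gridDet-square : ∀ m → gridDet (suc m) (suc m) ≡ false
-- Since `(0 , 0)` heads the list and lies on the diagonal, its row plus the weighted sum over
-- `rest` is, by computation, the sum over the whole grid.
gridDet-square m = Det-dependent-row adj (λ { (i , j) → i ≡ᵇ j }) (0 , 0) rest rest _ id
  (λ { {b , a} y∈ → dependent b a (∈-grid⁻ 0 M M y∈) })
  where
  M = suc m
  rest = map (0 ,_) (interval 1 m) ++ grid 1 m M
  dependent : ∀ b a → (0 ≤ b × b < M) × a < M →
    sum (grid 0 M M) (λ v → (proj₁ v ≡ᵇ proj₂ v) ∧ adj v (b , a)) ≡ false
  dependent b a ((_ , b<M) , a<M) = begin
    sum (grid 0 M M) (λ v → (proj₁ v ≡ᵇ proj₂ v) ∧ adj v (b , a))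
      ≡⟨ sum-adj M M (λ v → proj₁ v ≡ᵇ proj₂ v) b a b<M a<M ⟩
    sum (interval 0 M) (λ i → (b ≡ᵇ i) ∧ adj₁ i a) xor sum (interval 0 M) (λ i → (i ≡ᵇ a) ∧ adj₁ i b)
      ≡⟨ cong₂ _xor_
           (≡-trans (sum-cong (interval 0 M) (λ {i} _ → cong (_∧ adj₁ i a) (≡ᵇ-sym b i)))
             (sum-interval-pick 0 M b (λ i → adj₁ i a) z≤n b<M))
           (sum-interval-pick 0 M a (λ i → adj₁ i b) z≤n a<M) ⟩
    adj₁ b a xor adj₁ a b
      ≡⟨ cong (adj₁ b a xor_) (adj₁-sym a b) ⟩
    adj₁ b a xor adj₁ b a
      ≡⟨ xor-same (adj₁ b a) ⟩
    false ∎

coprime-+⁻ : ∀ {m n} → Coprime (n + m) n → Coprime m n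
coprime-+⁻ coprime (d∣m , d∣n) = coprime (∣m∣n⇒∣m+n d∣n d∣m , d∣n)

private
  Criterion : ℕ → ℕ → Set
  Criterion n m = gridDet n m ≡ true ⇔ Coprime (suc n) (suc m)

  criterion-comm : ∀ n m → Criterion n m → Criterion m n
  criterion-comm n m crit = mk⇔ {B = Coprime (suc m) (suc n)}
    (λ eq → Coprimality.sym {suc n} {suc m} (Equivalence.to crit (≡-trans (gridDet-comm n m) eq)))
    (λ coprime → ≡-trans (gridDet-comm m n) (Equivalence.from crit (Coprimality.sym {suc m} {suc n} coprime)))

  -- In terms of sizes increased by one, the reduction is the subtraction of `suc m` from
  -- `suc m + suc t`, which keeps the common divisors.
  criterion-step : ∀ t m → Criterion t m → Criterion (suc (m + t)) m
  criterion-step t m crit = mk⇔ {B = Coprime (suc (suc (m + t))) (suc m)}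
    (λ eq → subst (λ k → Coprime k (suc m)) (cong suc (+-suc m t))
      (coprime-+ {suc t} {suc m} (Equivalence.to crit (≡-trans (sym step) eq))))
    (λ coprime → ≡-trans step (Equivalence.from crit
      (coprime-+⁻ {suc t} {suc m} (subst (λ k → Coprime k (suc m)) (sym (cong suc (+-suc m t))) coprime))))
    where
    step : gridDet (suc (m + t)) m ≡ gridDet t m
    step = ≡-trans (cong (λ k → gridDet k m) (+-comm (suc m) t)) (gridDet-step t m)

  -- The bound `b` on the sum ensures termination. Squares end the recursion: size 0 yields the
  -- coprime pair 1, 1, and every other size a zero determinant and a nontrivial common divisor.
  euclid : ∀ b n m → n + m ≤ b → Criterion n m
  euclid b n m le with compare n m
  euclid b n .n le | equal .n = square n
    where
    square : ∀ n → Criterion n n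
    square zero    = mk⇔ {B = Coprime 1 1} (λ _ → Coprimality.1-coprimeTo 1) (λ _ → refl)
    square (suc n) = mk⇔ {B = Coprime (2 + n) (2 + n)}
      (λ eq → ⊥-elim (false≢true (≡-trans (sym (gridDet-square n)) eq)))
      (λ coprime → ⊥-elim (1+n≢0 (suc-injective (coprime (∣-refl , ∣-refl)))))
  euclid (suc b) .(suc (m + k)) m (s≤s le) | greater .m k =
    criterion-step k m (euclid b k m (≤-trans (+-monoˡ-≤ m (m≤n+m k m)) le))
  euclid zero n .(suc (n + k)) le | less .n k with () ← ≤-trans (≤-reflexive (sym (+-suc n (n + k)))) le
  euclid (suc b) n .(suc (n + k)) le | less .n k =
    criterion-comm (suc (n + k)) n (criterion-step k n (euclid b k n
      (≤-trans (≤-trans (≤-reflexive (+-comm k n)) (m≤n+m (n + k) n))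
        (≤-pred (≤-trans (≤-reflexive (sym (+-suc n (n + k)))) le)))))

gridDet-coprime : ∀ n m → gridDet n m ≡ true ⇔ Coprime (suc n) (suc m)
gridDet-coprime n m = euclid (n + m) n m ≤-refl

-- Parity, residues modulo 4 and greatest common divisors.

half : ∀ n → ∃ λ k → (odd n ≡ false × n ≡ k * 2) ⊎ (odd n ≡ true × n ≡ suc (k * 2))
half zero = 0 , inj₁ (refl , refl)
half (suc n) with half n
... | k , inj₁ (even , refl) = k     , inj₂ (cong not even , refl)
... | k , inj₂ (isOdd , refl) = suc k , inj₁ (cong not isOdd , refl)

odd-double : ∀ k → odd (k * 2) ≡ false
odd-double zero    = refl
odd-double (suc k) = ≡-trans (not-involutive _) (odd-double k)

odd⇔%2 : ∀ n → odd n ≡ true ⇔ n % 2 ≡ 1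
odd⇔%2 n with half n
... | k , inj₁ (even , refl) = mk⇔
  (λ eq → ⊥-elim (false≢true (≡-trans (sym even) eq)))
  (λ eq → ⊥-elim (1+n≢0 (sym (≡-trans (sym ([m+kn]%n≡m%n 0 k 2)) eq))))
... | k , inj₂ (isOdd , refl) = mk⇔ (λ _ → [m+kn]%n≡m%n 1 k 2) (λ _ → isOdd)

double-%4 : ∀ s → suc (s * 2) % 4 ≡ 1 ⇔ odd s ≡ false
double-%4 s with half s
... | k , inj₁ (even , refl) = mk⇔ (λ _ → even)
  (λ _ → ≡-trans (cong (λ x → suc x % 4) (*-assoc k 2 2)) ([m+kn]%n≡m%n 1 k 4))
... | k , inj₂ (isOdd , refl) = mk⇔
  (λ eq → ⊥-elim (contra (≡-trans (sym (≡-trans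
    (cong (λ x → (3 + x) % 4) (*-assoc k 2 2)) ([m+kn]%n≡m%n 3 k 4))) eq)))
  (λ eq → ⊥-elim (false≢true (≡-trans (sym eq) isOdd)))
  where
  contra : 3 ≢ 1
  contra ()

gcd-double : ∀ m n → gcd (m * 2) (n * 2) ≡ 2 * gcd m n
gcd-double m n = ≡-trans (cong₂ gcd (*-comm m 2) (*-comm n 2)) (sym (c*gcd[m,n]≡gcd[cm,cn] 2 m n))

-- If `suc s` and `suc k` are coprime, a common divisor of `suc s` and `suc k * 2` divides twice
-- both numbers, hence 2; it is 1 once `suc s` is odd. Conversely 2 would be a common divisor if
-- `suc s` were even.
coprime-double : ∀ s k → Coprime (suc s) (suc k * 2) ⇔ (odd s ≡ false × Coprime (suc s) (suc k))
coprime-double s k = mk⇔ {A = Coprime (suc s) (suc k * 2)} {B = odd s ≡ false × Coprime (suc s) (suc k)}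
  (λ coprime → s-even coprime , λ (d∣s , d∣k) → coprime (d∣s , ∣m⇒∣m*n 2 d∣k))
  (λ (even , coprime) {d} (d∣s , d∣k) → divisor-of-two even d∣s
    (coprime-factors {suc s} {suc k} {o = 2} coprime (∣m⇒∣m*n 2 d∣s , d∣k)))
  where
  s-even : Coprime (suc s) (suc k * 2) → odd s ≡ false
  s-even coprime with half s
  ... | j , inj₁ (even , _)  = even
  ... | j , inj₂ (_ , refl) = ⊥-elim (1+n≢0 (suc-injective
    (coprime {2} (n∣m*n (suc j) , n∣m*n (suc k)))))

  divisor-of-two : odd s ≡ false → ∀ {d} → d ∣ suc s → d ∣ 2 → d ≡ 1
  divisor-of-two even {0} d∣s d∣2 = ⊥-elim (1+n≢0 (0∣⇒≡0 d∣2))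
  divisor-of-two even {1} d∣s d∣2 = refl
  divisor-of-two even {2} (divides q eq) d∣2 = ⊥-elim (false≢true (sym (≡-trans (cong not (sym even))
    (≡-trans (cong odd eq) (odd-double q)))))
  divisor-of-two even {suc (suc (suc d))} d∣s d∣2 with s≤s (s≤s ()) ← ∣⇒≤ d∣2

coprime-gcd-double : ∀ m n → Coprime m n ⇔ gcd (m * 2) (n * 2) ≡ 2
coprime-gcd-double m n = mk⇔ {A = Coprime m n}
  (λ coprime → ≡-trans (gcd-double m n) (cong (2 *_) (coprime⇒gcd≡1 coprime)))
  (λ eq → gcd≡1⇒coprime (*-cancelˡ-≡ (gcd m n) 1 2 (≡-trans (sym (gcd-double m n)) eq)))

%2≡1⇒half : ∀ n → n % 2 ≡ 1 → ∃ λ k → n ≡ suc (k * 2)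
%2≡1⇒half n eq = n / 2 , ≡-trans (m≡m%n+[m/n]*n n 2) (cong (_+ n / 2 * 2) eq)

∧-not-true : ∀ {a b} → a ∧ not b ≡ true → a ≡ true × b ≡ false
∧-not-true {true} {false} _ = refl , refl

nearPerfectCount-odd : ∀ s k → odd (nearPerfectCount (suc (s * 2)) (suc (k * 2))) ≡ true ⇔
  (odd k ≡ false × odd s ≡ false × Coprime (suc s) (suc k))
nearPerfectCount-odd s k = mk⇔
  (λ eq → let g , even-k = ∧-not-true (≡-trans (sym count) eq) in
    even-k , to (coprime-double s k) (to (gridDet-coprime s (suc (k * 2))) g))
  (λ (even-k , coprime) → ≡-trans count (cong₂ _∧_
    (from (gridDet-coprime s (suc (k * 2))) (from (coprime-double s k) coprime)) (cong not even-k)))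
  where
  open Equivalence
  count : odd (nearPerfectCount (suc (s * 2)) (suc (k * 2))) ≡ gridDet s (suc (k * 2)) ∧ not (odd k)
  count = ≡-trans (cong (λ r → odd (nearPerfectCount r (suc (k * 2)))) shape) (nearPerfectCount-gridDet s k)
    where
    shape : suc (s * 2) ≡ s + suc s
    shape = ≡-trans (cong suc (≡-trans (*-comm s 2) (cong (s +_) (+-identityʳ s)))) (sym (+-suc s s))

theorem10 : (r c : ℕ) → r % 2 ≡ 1 → c % 2 ≡ 1 →
    (nearPerfectCount r c % 2 ≡ 1 ⇔
    (r % 4 ≡ 1 × c % 4 ≡ 1 × gcd (r + 1) (c + 1) ≡ 2))
theorem10 r c r-odd c-odd with %2≡1⇒half r r-odd | %2≡1⇒half c c-odd
... | s , refl | k , refl = mk⇔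
  (λ eq → let even-k , even-s , coprime = to (nearPerfectCount-odd s k) (from (odd⇔%2 count) eq) in
    from (double-%4 s) even-s , from (double-%4 k) even-k ,
    ≡-trans gcd-shape (to (coprime-gcd-double (suc s) (suc k)) coprime))
  (λ (r%4 , c%4 , gcd≡2) → to (odd⇔%2 count) (from (nearPerfectCount-odd s k)
    (to (double-%4 k) c%4 , to (double-%4 s) r%4 ,
     from (coprime-gcd-double (suc s) (suc k)) (≡-trans (sym gcd-shape) gcd≡2))))
  where
  open Equivalence
  count = nearPerfectCount (suc (s * 2)) (suc (k * 2))
  gcd-shape : gcd (suc (s * 2) + 1) (suc (k * 2) + 1) ≡ gcd (suc s * 2) (suc k * 2)
  gcd-shape = cong₂ gcd (+-comm (suc (s * 2)) 1) (+-comm (suc (k * 2)) 1)
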